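{- For all $\varepsilon>0$ and integers $r\geq 2$ there exist $\xi=\xi(\varepsilon,r)>0$, $L=L(\varepsilon,r)$ and $n_0$ such that for every graph $H$ of order $r$ and every graph $G$ of order $n\geq n_0$ the following holds: if $k_H(G)<\xi n^r$, then there exists an equitable partition $V(G)=\bigcup_{i=0}^{q}V_i$ with $q<L$ such that for every $i\in[q]$, \[ e(V_i)<\varepsilon\binom{|V_i|}{2}\quad\text{or}\quad e(V_i)>(1-\varepsilon)\binom{|V_i|}{2}. \]
   Context: All graphs are finite and simple. $k_H(G)$ denotes the number of induced copies of $H$ in $G$. For $U\subset V(G)$, $e(U)$ is the number of edges of $G[U]$. A partition $V=\bigcup_{i=0}^{k}V_i$ is equitable if $|V_0|<k$ and $|V_1|=\dots=|V_k|$. $[q]=\{1,\dots,q\}$. -}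

module Defs where

open import Data.Bool using (Bool; true; false; _∧_; if_then_else_)
open import Data.Nat using (ℕ; zero; suc; _<_; _≡ᵇ_)
open import Data.Nat.Combinatorics using (_C_)
open import Data.Fin using (Fin; toℕ)
open import Data.Fin.Subset using (Subset)
open import Data.List using (List; []; _∷_; [_]; map; concatMap; length; filterᵇ; allFin)
open import Data.Bool.ListAction using (all; any)
open import Data.Vec using (Vec; lookup) renaming ([] to []ᵥ; _∷_ to _∷ᵥ_)
open import Data.Product using (_×_; _,_)
open import Data.Integer using (+_)
open import Data.Rational using (ℚ; _/_)
open import Relation.Binary.PropositionalEquality using (_≡_)
open import Relation.Nullary using (does)
import Data.Fin as F

record Graph (n : ℕ) : Set where
  field
    adj    : Fin n → Fin n → Bool
    sym    : ∀ i j → adj i j ≡ adj j i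
    irrefl : ∀ i → adj i i ≡ false
open Graph public

toℚ : ℕ → ℚ
toℚ m = + m / 1

_=ᶠ_ : ∀ {n} → Fin n → Fin n → Bool
a =ᶠ b = does (a F.≟ b)

_=ᵇ_ : Bool → Bool → Bool
true  =ᵇ b = b
false =ᵇ true  = false
false =ᵇ false = true

not : Bool → Bool
not true = false
not false = true

count : ∀ {A : Set} → (A → Bool) → List A → ℕ
count p xs = length (filterᵇ p xs)

allVecs : (r n : ℕ) → List (Vec (Fin n) r)
allVecs zero    n = [ []ᵥ ]
allVecs (suc r) n = concatMap (λ v → map (_∷ᵥ v) (allFin n)) (allVecs r n)

allSubsets : (n : ℕ) → List (Subset n)
allSubsets zero    = [ []ᵥ ]
allSubsets (suc n) = concatMap (λ s → (true ∷ᵥ s) ∷ [ false ∷ᵥ s ]) (allSubsets n)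

size : ∀ {n} → Subset n → ℕ
size {n} S = count (λ v → lookup S v) (allFin n)

-- f : Fin r → Fin n (as a vector) is an isomorphism from H onto G[S]:
-- injective, image contained in S, and adjacency preserved and reflected.
-- Together with |S| = r this says the image is exactly S.
isIsoOnto : ∀ {r n} → Graph r → Graph n → Subset n → Vec (Fin n) r → Bool
isIsoOnto {r} {n} H G S f =
  all (λ a → lookup S (lookup f a)) (allFin r) ∧
  all (λ a → all (λ b →
         (not (a =ᶠ b) ∧ not (lookup f a =ᶠ lookup f b) ∨' (a =ᶠ b)) ∧
         (adj H a b =ᵇ adj G (lookup f a) (lookup f b))) (allFin r)) (allFin r)
  where
    _∨'_ : Bool → Bool → Bool
    true ∨' _ = true
    false ∨' b = b
    infixr 5 _∨'_

inducesCopy : ∀ {r n} → Graph r → Graph n → Subset n → Bool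
inducesCopy {r} {n} H G S = (size S ≡ᵇ r) ∧ any (isIsoOnto H G S) (allVecs r n)

kH : ∀ {r n} → Graph r → Graph n → ℕ
kH {r} {n} H G = count (inducesCopy H G) (allSubsets n)

pairs : (n : ℕ) → List (Fin n × Fin n)
pairs n = concatMap (λ i → map (λ j → (i , j)) (filterᵇ (λ j → does (toℕ i Data.Nat.<? toℕ j)) (allFin n))) (allFin n)

e : ∀ {n} → Graph n → Subset n → ℕ
e {n} G U = count (λ { (i , j) → lookup U i ∧ lookup U j ∧ adj G i j }) (pairs n)

-- A partition V(G) = V_0 ∪ V_1 ∪ ... ∪ V_q, given by the part index of each vertex.
-- The class V_i as a subset:
class : ∀ {n q} → (Fin n → Fin (suc q)) → Fin (suc q) → Subset n
class {n} part i = Data.Vec.tabulate (λ v → part v =ᶠ i)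

Equitable : ∀ {n} q → (Fin n → Fin (suc q)) → Set
Equitable q part =
  size (class part F.zero) < q ×
  (∀ (i j : Fin q) → size (class part (F.suc i)) ≡ size (class part (F.suc j)))

{-# OPTIONS --safe #-}
-- No regularity lemma is needed. Embedding H greedily, vertex by vertex, into a large vertex set either
-- yields many copies of H or gets stuck; in the latter case averaging produces two disjoint large sets A, B
-- such that the pairs between them are almost all edges or almost all non-edges. Recursing inside A and
-- inside B with much smaller sets, whose union inherits the sparseness (or denseness) between A and B,
-- gives after enough doublings a linear-sized set of density close to 0 or 1. Such sets of equal size are
-- removed greedily until few vertices remain, and these are shared out equally: this changes the densities
-- only slightly and leaves fewer vertices than there are sets.
module Submission where

open import Defs
open import Data.Nat using (ℕ; suc; _≤_; _<_; _^_)
open import Data.Nat.Combinatorics using (_C_)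
open import Data.Fin using (Fin)
open import Data.Product using (Σ; _×_; _,_; proj₁; proj₂)
open import Data.Sum as Sum using (_⊎_; inj₁; inj₂)
open import Function using (case_of_)
open import Relation.Binary.PropositionalEquality using (_≡_; _≢_; refl; trans; cong; cong₂; subst; subst₂; module ≡-Reasoning) renaming (sym to ≡-sym)

-- The obstacle is that a stuck embedding may make either colour rare, and which one cannot be
-- chosen. The recursion therefore carries two targets, as in the proof of Ramsey's theorem: `a`
-- doublings with rare edges or `b` doublings with rare non-edges. A pair with one rare colour
-- lowers the target of that colour on both of its sides, and a side that reaches the other target
-- finishes at once. After `a` doublings of seeds of `m` vertices the rare colour has at most a
-- fraction 3 / 2^a of the ordered pairs. This works because rare pairs are measured against the
-- seed: a pair found at scale `K * m` is so sparse that it contains at most m² rare pairs in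
-- absolute number, a bound that survives every passage to subsets. The factor `K` depends only on r
-- and the two targets, so the removal of sets can continue as long as `K * m` vertices are left.
-- All estimates stay in ℕ. Only the denominator d of ε enters them, since 1/d ≤ ε, and pairs are
-- counted as ordered, so that edges, non-edges and the diagonal of S add up to |S|².

module Combinatorics where

  open import Data.Bool using (Bool; true; false; _∧_; _∨_; if_then_else_; T)
  open import Data.Bool.ListAction using (all; any)
  open import Data.Bool.Properties using (∧-identityʳ; ∧-zeroʳ; ∨-identityʳ)
  open import Data.Empty using (⊥-elim)
  open import Data.Fin as Fin using (zero; suc; toℕ)
  import Data.Fin.Properties as Fin
  open import Data.Fin.Subset using (Subset)
  open import Data.List using (List; []; _∷_; [_]; map; concatMap; _++_; filterᵇ; allFin; tabulate; length)
  open import Data.List.Membership.Propositional using (_∈_; lose)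
  open import Data.List.Membership.Propositional.Properties using (∈-map⁺; ∈-allFin; ∈-concatMap⁺)
  open import Data.List.Properties using (length-tabulate)
  open import Data.List.Relation.Unary.Any using (here; there)
  open import Data.Nat using (zero; _+_; _*_; _∸_; _/_; _%_; _≡ᵇ_; _<?_; _≤?_; z≤n; s≤s; NonZero; >-nonZero)
  open import Data.Nat.Combinatorics using (nC1≡n; nCk+nC[k+1]≡[n+1]C[k+1])
  open import Data.Nat.DivMod using (m≡m%n+[m/n]*n; m%n<n; m*n/n≡m; m/n*n≤m; /-monoˡ-≤)
  open import Data.Nat.Properties
  open import Data.Nat.Tactic.RingSolver using (solve-∀)
  open import Data.Unit using (⊤; tt)
  open import Data.Vec as Vec using (Vec; lookup) renaming ([] to []ᵥ; _∷_ to _∷ᵥ_)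
  open import Data.Vec.Properties using (lookup∘tabulate)
  open import Function using (_∘_; id)
  open import Relation.Binary.Definitions using (tri<; tri≈; tri>)
  open import Relation.Nullary using (¬_; Dec; does; yes; no)

  -- Truth values as the numbers 0 and 1

  ⟦_⟧ : Bool → ℕ
  ⟦ true ⟧ = 1
  ⟦ false ⟧ = 0

  ⟦∧⟧ : ∀ a b → ⟦ a ∧ b ⟧ ≡ ⟦ a ⟧ * ⟦ b ⟧
  ⟦∧⟧ true b = ≡-sym (+-identityʳ ⟦ b ⟧)
  ⟦∧⟧ false b = refl

  ⟦⟧≤1 : ∀ a → ⟦ a ⟧ ≤ 1
  ⟦⟧≤1 true = ≤-refl
  ⟦⟧≤1 false = z≤n

  ⟦⟧-mono : ∀ {a b} → (a ≡ true → b ≡ true) → ⟦ a ⟧ ≤ ⟦ b ⟧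
  ⟦⟧-mono {false} h = z≤n
  ⟦⟧-mono {true} h rewrite h refl = ≤-refl

  ∧-trueˡ : ∀ {a b} → a ∧ b ≡ true → a ≡ true
  ∧-trueˡ {true} _ = refl

  ∧-trueʳ : ∀ {a b} → a ∧ b ≡ true → b ≡ true
  ∧-trueʳ {true} h = h

  ∧-true : ∀ {a b} → a ≡ true → b ≡ true → a ∧ b ≡ true
  ∧-true refl h = h

  not-true : ∀ {a} → not a ≡ true → a ≡ false
  not-true {false} _ = refl

  true≢false : ∀ {A : Set} {a} → a ≡ true → a ≡ false → A
  true≢false refl ()

  does-true : ∀ {P : Set} (d : Dec P) → does d ≡ true → P
  does-true (yes p) _ = p

  does-false : ∀ {P : Set} (d : Dec P) → does d ≡ false → ¬ P
  does-false (no p) _ = p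

  true-does : ∀ {P : Set} (d : Dec P) → P → does d ≡ true
  true-does (yes _) _ = refl
  true-does (no ¬p) p = ⊥-elim (¬p p)

  false-does : ∀ {P : Set} (d : Dec P) → ¬ P → does d ≡ false
  false-does (yes p) ¬p = ⊥-elim (¬p p)
  false-does (no _) _ = refl

  *-swapˡ : ∀ a b c → a * (b * c) ≡ b * (a * c)
  *-swapˡ = solve-∀

  -- Finite sums

  ∑ : {A : Set} → List A → (A → ℕ) → ℕ
  ∑ [] f = 0
  ∑ (x ∷ xs) f = f x + ∑ xs f

  module _ {A : Set} where

    ∑-mono : ∀ (xs : List A) {f g : A → ℕ} → (∀ x → f x ≤ g x) → ∑ xs f ≤ ∑ xs g
    ∑-mono [] h = z≤n
    ∑-mono (x ∷ xs) h = +-mono-≤ (h x) (∑-mono xs h)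

    ∑-cong : ∀ (xs : List A) {f g : A → ℕ} → (∀ x → f x ≡ g x) → ∑ xs f ≡ ∑ xs g
    ∑-cong [] h = refl
    ∑-cong (x ∷ xs) h = cong₂ _+_ (h x) (∑-cong xs h)

    ∑-zero : ∀ (xs : List A) → ∑ xs (λ _ → 0) ≡ 0
    ∑-zero [] = refl
    ∑-zero (x ∷ xs) = ∑-zero xs

    ∑-+ : ∀ (xs : List A) (f g : A → ℕ) → ∑ xs (λ x → f x + g x) ≡ ∑ xs f + ∑ xs g
    ∑-+ [] f g = refl
    ∑-+ (x ∷ xs) f g = trans (cong (f x + g x +_) (∑-+ xs f g)) (lem (f x) (g x) (∑ xs f) (∑ xs g))
      where
      lem : ∀ a b c d → a + b + (c + d) ≡ a + c + (b + d)
      lem = solve-∀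

    ∑-*ˡ : ∀ (xs : List A) c (f : A → ℕ) → ∑ xs (λ x → c * f x) ≡ c * ∑ xs f
    ∑-*ˡ [] c f = ≡-sym (*-zeroʳ c)
    ∑-*ˡ (x ∷ xs) c f = trans (cong (c * f x +_) (∑-*ˡ xs c f)) (≡-sym (*-distribˡ-+ c (f x) (∑ xs f)))

    ∑-*ʳ : ∀ (xs : List A) c (f : A → ℕ) → ∑ xs (λ x → f x * c) ≡ ∑ xs f * c
    ∑-*ʳ xs c f = trans (∑-cong xs (λ x → *-comm (f x) c)) (trans (∑-*ˡ xs c f) (*-comm c (∑ xs f)))

    ∑-const : ∀ (xs : List A) c → ∑ xs (λ _ → c) ≡ length xs * c
    ∑-const [] c = refl
    ∑-const (x ∷ xs) c = cong (c +_) (∑-const xs c)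

    ∑-++ : ∀ (xs ys : List A) (f : A → ℕ) → ∑ (xs ++ ys) f ≡ ∑ xs f + ∑ ys f
    ∑-++ [] ys f = refl
    ∑-++ (x ∷ xs) ys f = trans (cong (f x +_) (∑-++ xs ys f)) (≡-sym (+-assoc (f x) (∑ xs f) (∑ ys f)))

    ∑-filterᵇ : ∀ (p : A → Bool) (xs : List A) (f : A → ℕ) →
      ∑ (filterᵇ p xs) f ≡ ∑ xs (λ x → ⟦ p x ⟧ * f x)
    ∑-filterᵇ p [] f = refl
    ∑-filterᵇ p (x ∷ xs) f with p x
    ... | true = cong₂ _+_ (≡-sym (+-identityʳ (f x))) (∑-filterᵇ p xs f)
    ... | false = ∑-filterᵇ p xs f

    count≡∑ : ∀ (p : A → Bool) xs → count p xs ≡ ∑ xs (⟦_⟧ ∘ p)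
    count≡∑ p [] = refl
    count≡∑ p (x ∷ xs) with p x
    ... | true = cong suc (count≡∑ p xs)
    ... | false = count≡∑ p xs

    ∑-weighted-≤ : ∀ (xs : List A) (P : A → Bool) {f : A → ℕ} {c} →
      (∀ x → P x ≡ true → f x ≤ c) → ∑ xs (λ x → ⟦ P x ⟧ * f x) ≤ ∑ xs (⟦_⟧ ∘ P) * c
    ∑-weighted-≤ xs P {f} {c} h = ≤-trans (∑-mono xs pt) (≤-reflexive (∑-*ʳ xs c (⟦_⟧ ∘ P)))
      where
      pt : ∀ x → ⟦ P x ⟧ * f x ≤ ⟦ P x ⟧ * c
      pt x with P x | h x
      ... | true | b = *-monoʳ-≤ 1 (b refl)
      ... | false | _ = z≤n

    ∑-weighted-≥ : ∀ (xs : List A) (P : A → Bool) {f : A → ℕ} {c} →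
      (∀ x → P x ≡ true → c ≤ f x) → ∑ xs (⟦_⟧ ∘ P) * c ≤ ∑ xs (λ x → ⟦ P x ⟧ * f x)
    ∑-weighted-≥ xs P {f} {c} h = ≤-trans (≤-reflexive (≡-sym (∑-*ʳ xs c (⟦_⟧ ∘ P)))) (∑-mono xs pt)
      where
      pt : ∀ x → ⟦ P x ⟧ * c ≤ ⟦ P x ⟧ * f x
      pt x with P x | h x
      ... | true | b = *-monoʳ-≤ 1 (b refl)
      ... | false | _ = z≤n

  module _ {A B : Set} where

    ∑-swap : ∀ (xs : List A) (ys : List B) (f : A → B → ℕ) →
      ∑ xs (λ x → ∑ ys (f x)) ≡ ∑ ys (λ y → ∑ xs (λ x → f x y))
    ∑-swap [] ys f = ≡-sym (∑-zero ys)
    ∑-swap (x ∷ xs) ys f =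
      trans (cong (∑ ys (f x) +_) (∑-swap xs ys f)) (≡-sym (∑-+ ys (f x) (λ y → ∑ xs (λ x → f x y))))

    ∑-map : ∀ (g : A → B) (xs : List A) (f : B → ℕ) → ∑ (map g xs) f ≡ ∑ xs (f ∘ g)
    ∑-map g [] f = refl
    ∑-map g (x ∷ xs) f = cong (f (g x) +_) (∑-map g xs f)

    ∑-concatMap : ∀ (g : A → List B) (xs : List A) (f : B → ℕ) →
      ∑ (concatMap g xs) f ≡ ∑ xs (λ x → ∑ (g x) f)
    ∑-concatMap g [] f = refl
    ∑-concatMap g (x ∷ xs) f =
      trans (∑-++ (g x) (concatMap g xs) f) (cong (∑ (g x) f +_) (∑-concatMap g xs f))

  -- Sets of vertices

  ∑ᶠ : ∀ {n} → (Fin n → ℕ) → ℕ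
  ∑ᶠ {n} f = ∑ (allFin n) f

  ∑-tabulate : ∀ {A : Set} n (g : Fin n → A) (f : A → ℕ) → ∑ (tabulate g) f ≡ ∑ᶠ (f ∘ g)
  ∑-tabulate zero g f = refl
  ∑-tabulate (suc n) g f = cong (f (g zero) +_)
    (trans (∑-tabulate n (g ∘ suc) f) (≡-sym (∑-tabulate n suc (f ∘ g))))

  VSet : ℕ → Set
  VSet n = Fin n → Bool

  infix 4 _⊆_
  _⊆_ : ∀ {n} → VSet n → VSet n → Set
  P ⊆ Q = ∀ v → P v ≡ true → Q v ≡ true

  Disjoint : ∀ {n} → VSet n → VSet n → Set
  Disjoint P Q = ∀ v → P v ≡ true → Q v ≡ false

  # : ∀ {n} → VSet n → ℕ
  # P = ∑ᶠ (⟦_⟧ ∘ P)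

  #-cong : ∀ {n} {P Q : VSet n} → (∀ v → P v ≡ Q v) → # P ≡ # Q
  #-cong {n} h = ∑-cong (allFin n) (λ v → cong ⟦_⟧ (h v))

  #-full : ∀ n → # {n} (λ _ → true) ≡ n
  #-full n = trans (∑-const (allFin n) 1) (trans (*-identityʳ _) (length-tabulate id))

  _∪_ : ∀ {n} → VSet n → VSet n → VSet n
  (P ∪ Q) v = P v ∨ Q v

  ⟦∪⟧ : ∀ {n} (P Q : VSet n) → Disjoint P Q → ∀ v → ⟦ (P ∪ Q) v ⟧ ≡ ⟦ P v ⟧ + ⟦ Q v ⟧
  ⟦∪⟧ P Q d v with P v | d v
  ... | true | h rewrite h refl = refl
  ... | false | _ = refl

  #-∪ : ∀ {n} (P Q : VSet n) → Disjoint P Q → # (P ∪ Q) ≡ # P + # Q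
  #-∪ {n} P Q d = trans (∑-cong (allFin n) (⟦∪⟧ P Q d)) (∑-+ (allFin n) (⟦_⟧ ∘ P) (⟦_⟧ ∘ Q))

  ∪-⊆ : ∀ {n} {P Q W : VSet n} → P ⊆ W → Q ⊆ W → (P ∪ Q) ⊆ W
  ∪-⊆ {P = P} p q v h with P v | p v
  ... | true | k = k refl
  ... | false | _ = q v h

  _∖_ : ∀ {n} → VSet n → VSet n → VSet n
  (P ∖ Q) v = P v ∧ not (Q v)

  #-∖ : ∀ {n} (P Q : VSet n) → Q ⊆ P → # P ≡ # Q + # (P ∖ Q)
  #-∖ {n} P Q s = trans (∑-cong (allFin n) pt) (∑-+ (allFin n) (⟦_⟧ ∘ Q) (⟦_⟧ ∘ (P ∖ Q)))
    where
    pt : ∀ v → ⟦ P v ⟧ ≡ ⟦ Q v ⟧ + ⟦ (P ∖ Q) v ⟧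
    pt v with P v | Q v | s v
    ... | true | true | _ = refl
    ... | true | false | _ = refl
    ... | false | true | h with h refl
    ... | ()
    pt v | false | false | _ = refl

  subset-of-size : ∀ {n} (P : VSet n) m → m ≤ # P → Σ (VSet n) λ Q → Q ⊆ P × # Q ≡ m
  subset-of-size {n} P zero _ = (λ _ → false) , (λ _ ()) , ∑-zero (allFin n)
  subset-of-size {zero} P (suc m) ()
  subset-of-size {suc n} P (suc m) h with P zero in eq
  ... | false = let (Q , s , c) = subset-of-size (P ∘ suc) (suc m) (subst (suc m ≤_) (∑-tabulate n suc (⟦_⟧ ∘ P)) h) in
    (λ { zero → false ; (suc v) → Q v }) , (λ { (suc v) → s v }) , trans (∑-tabulate n suc _) c
  ... | true = let (Q , s , c) = subset-of-size (P ∘ suc) m (subst (m ≤_) (∑-tabulate n suc (⟦_⟧ ∘ P)) (≤-pred h)) in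
    (λ { zero → true ; (suc v) → Q v }) , (λ { zero _ → eq ; (suc v) → s v }) , cong suc (trans (∑-tabulate n suc _) c)

  =ᶠ-refl : ∀ {n} (v : Fin n) → (v =ᶠ v) ≡ true
  =ᶠ-refl v = true-does (v Fin.≟ v) refl

  ∑ᶠ-δ : ∀ {n} (v : Fin n) (f : Fin n → ℕ) → ∑ᶠ (λ u → ⟦ v =ᶠ u ⟧ * f u) ≡ f v
  ∑ᶠ-δ {suc n} zero f = trans (cong₂ _+_ (+-identityʳ (f zero)) (trans (∑-tabulate n suc _) (∑-zero (allFin n)))) (+-identityʳ (f zero))
  ∑ᶠ-δ {suc n} (suc v) f = trans (∑-tabulate n suc _) (∑ᶠ-δ v (f ∘ suc))

  -- For arguments in which a single index can end everything: a homogeneous pair found at one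
  -- vertex is already the result, and otherwise the desired bound is available at all vertices
  -- together.
  fin-choice : ∀ {n} {A : Set} {B : Fin n → Set} → (∀ v → A ⊎ B v) → A ⊎ (∀ v → B v)
  fin-choice {zero} h = inj₂ λ ()
  fin-choice {suc n} h with h zero | fin-choice (h ∘ suc)
  ... | inj₁ a | _ = inj₁ a
  ... | inj₂ _ | inj₁ a = inj₁ a
  ... | inj₂ b | inj₂ bs = inj₂ λ { zero → b ; (suc v) → bs v }

  -- Edges between weighted vertex sets

  module _ {n : ℕ} (R : Fin n → Fin n → Bool) where

    -- Weights instead of sets make the count bilinear, so that a disjoint union expands like the
    -- square of a sum. Pairs are ordered: for symmetric `R`, two distinct related vertices of one
    -- set count twice.
    cross : (f g : Fin n → ℕ) → ℕ
    cross f g = ∑ᶠ λ v → f v * ∑ᶠ λ u → g u * ⟦ R v u ⟧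

    cross-cong : ∀ {f f′ g g′} → (∀ v → f v ≡ f′ v) → (∀ v → g v ≡ g′ v) → cross f g ≡ cross f′ g′
    cross-cong p q = ∑-cong (allFin n) λ v → cong₂ _*_ (p v) (∑-cong (allFin n) λ u → cong (_* ⟦ R v u ⟧) (q u))

    cross-mono : ∀ {f f′ g g′} → (∀ v → f v ≤ f′ v) → (∀ v → g v ≤ g′ v) → cross f g ≤ cross f′ g′
    cross-mono p q = ∑-mono (allFin n) λ v → *-mono-≤ (p v) (∑-mono (allFin n) λ u → *-monoˡ-≤ ⟦ R v u ⟧ (q u))

    cross-swap : ∀ f g → cross f g ≡ ∑ᶠ λ u → g u * ∑ᶠ λ v → f v * ⟦ R v u ⟧
    cross-swap f g = begin
      cross f g
        ≡⟨ ∑-cong (allFin n) (λ v → ≡-sym (∑-*ˡ (allFin n) (f v) _)) ⟩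
      ∑ᶠ (λ v → ∑ᶠ λ u → f v * (g u * ⟦ R v u ⟧))
        ≡⟨ ∑-swap (allFin n) (allFin n) _ ⟩
      ∑ᶠ (λ u → ∑ᶠ λ v → f v * (g u * ⟦ R v u ⟧))
        ≡⟨ ∑-cong (allFin n) (λ u → trans (∑-cong (allFin n) λ v → *-swapˡ (f v) (g u) ⟦ R v u ⟧) (∑-*ˡ (allFin n) (g u) _)) ⟩
      ∑ᶠ (λ u → g u * ∑ᶠ λ v → f v * ⟦ R v u ⟧) ∎
      where
      open ≡-Reasoning

    cross-+ˡ : ∀ f f′ g → cross (λ v → f v + f′ v) g ≡ cross f g + cross f′ g
    cross-+ˡ f f′ g = trans (∑-cong (allFin n) λ v → *-distribʳ-+ _ (f v) (f′ v)) (∑-+ (allFin n) _ _)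

    cross-+ʳ : ∀ f g g′ → cross f (λ v → g v + g′ v) ≡ cross f g + cross f g′
    cross-+ʳ f g g′ = trans (∑-cong (allFin n) λ v →
        trans (cong (f v *_) (trans (∑-cong (allFin n) λ u → *-distribʳ-+ ⟦ R v u ⟧ (g u) (g′ u)) (∑-+ (allFin n) _ _)))
              (*-distribˡ-+ (f v) _ _))
      (∑-+ (allFin n) _ _)

    cross-≤ : ∀ f g → cross f g ≤ ∑ᶠ f * ∑ᶠ g
    cross-≤ f g = ≤-trans
      (∑-mono (allFin n) λ v → *-monoʳ-≤ (f v) (∑-mono (allFin n) λ u →
        ≤-trans (*-monoʳ-≤ (g u) (⟦⟧≤1 (R v u))) (≤-reflexive (*-identityʳ (g u)))))
      (≤-reflexive (∑-*ʳ (allFin n) (∑ᶠ g) f))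

    cross-sym : (∀ v u → R v u ≡ R u v) → ∀ f g → cross f g ≡ cross g f
    cross-sym s f g = trans (cross-swap f g)
      (∑-cong (allFin n) λ u → cong (g u *_) (∑-cong (allFin n) λ v → cong (λ b → f v * ⟦ b ⟧) (s v u)))

    between : (A B : VSet n) → ℕ
    between A B = cross (⟦_⟧ ∘ A) (⟦_⟧ ∘ B)

    between-∪ : (∀ v u → R v u ≡ R u v) → ∀ A B → Disjoint A B →
      between (A ∪ B) (A ∪ B) ≡ between A A + between B B + 2 * between A B
    between-∪ s A B d = begin
      between (A ∪ B) (A ∪ B)
        ≡⟨ cross-cong (⟦∪⟧ A B d) (⟦∪⟧ A B d) ⟩
      cross (λ v → a v + b v) (λ v → a v + b v)
        ≡⟨ cross-+ˡ a b (λ v → a v + b v) ⟩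
      cross a (λ v → a v + b v) + cross b (λ v → a v + b v)
        ≡⟨ cong₂ _+_ (cross-+ʳ a a b) (cross-+ʳ b a b) ⟩
      cross a a + cross a b + (cross b a + cross b b)
        ≡⟨ cong (λ x → cross a a + cross a b + (x + cross b b)) (cross-sym s b a) ⟩
      cross a a + cross a b + (cross a b + cross b b)
        ≡⟨ lem (cross a a) (cross a b) (cross b b) ⟩
      between A A + between B B + 2 * between A B ∎
      where
      open ≡-Reasoning
      a = ⟦_⟧ ∘ A
      b = ⟦_⟧ ∘ B
      lem : ∀ x y z → x + y + (y + z) ≡ x + z + 2 * y
      lem = solve-∀

    -- Markov: at least half of U sees few vertices of A.
    sparse-partner : ∀ E m (A U : VSet n) → 0 < m → # A ≡ m → 4 * m ≤ # U →
      (∀ v → A v ≡ true → 2 * E * # (λ u → U u ∧ R v u) ≤ # U) →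
      Σ (VSet n) λ B → B ⊆ U × Disjoint A B × # B ≡ m × E * between A B ≤ m * m
    sparse-partner E m A U m>0 refl 4m≤U few =
      B , (λ v h → ∧-trueˡ (∧-trueˡ (B⊆ v h))) , disj , #B , bound
      where
      deg : Fin n → ℕ
      deg u = ∑ᶠ λ v → ⟦ A v ⟧ * ⟦ R v u ⟧
      Q : VSet n
      Q u = does (m <? E * deg u)
      heavy light : VSet n
      heavy u = U u ∧ Q u
      light u = (U u ∧ not (Q u)) ∧ not (A u)
      cover : ∀ u → ⟦ U u ⟧ ≤ ⟦ heavy u ⟧ + (⟦ A u ⟧ + ⟦ light u ⟧)
      cover u with U u | Q u | A u
      ... | false | _ | _ = z≤n
      ... | true | true | _ = s≤s z≤n
      ... | true | false | true = s≤s z≤n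
      ... | true | false | false = s≤s z≤n
      U≤ : # U ≤ # heavy + (m + # light)
      U≤ = ≤-trans (∑-mono (allFin n) cover)
        (≤-reflexive (trans (∑-+ (allFin n) _ _) (cong (# heavy +_) (∑-+ (allFin n) _ _))))
      edges : 2 * (E * between A U) ≤ m * # U
      edges = begin
        2 * (E * between A U) ≡⟨ ≡-sym (*-assoc 2 E _) ⟩
        2 * E * between A U ≡⟨ ≡-sym (∑-*ˡ (allFin n) (2 * E) _) ⟩
        ∑ᶠ (λ v → 2 * E * (⟦ A v ⟧ * d v)) ≡⟨ ∑-cong (allFin n) (λ v → *-swapˡ (2 * E) ⟦ A v ⟧ (d v)) ⟩
        ∑ᶠ (λ v → ⟦ A v ⟧ * (2 * E * d v)) ≤⟨ ∑-weighted-≤ (allFin n) A (λ v h → ≤-trans (≤-reflexive (cong (2 * E *_) (∑-cong (allFin n) λ u → ≡-sym (⟦∧⟧ (U u) (R v u))))) (few v h)) ⟩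
        m * # U ∎
        where
        open ≤-Reasoning
        d : Fin n → ℕ
        d v = ∑ᶠ λ u → ⟦ U u ⟧ * ⟦ R v u ⟧
      heavy-edges : # heavy * m ≤ E * between A U
      heavy-edges = begin
        # heavy * m ≤⟨ ∑-weighted-≥ (allFin n) heavy (λ u h → <⇒≤ (does-true (m <? E * deg u) (∧-trueʳ {U u} h))) ⟩
        ∑ᶠ (λ u → ⟦ heavy u ⟧ * (E * deg u)) ≤⟨ ∑-mono (allFin n) (λ u → *-monoˡ-≤ (E * deg u) (⟦⟧-mono (∧-trueˡ {U u}))) ⟩
        ∑ᶠ (λ u → ⟦ U u ⟧ * (E * deg u)) ≡⟨ ∑-cong (allFin n) (λ u → *-swapˡ ⟦ U u ⟧ E (deg u)) ⟩
        ∑ᶠ (λ u → E * (⟦ U u ⟧ * deg u)) ≡⟨ ∑-*ˡ (allFin n) E _ ⟩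
        E * ∑ᶠ (λ u → ⟦ U u ⟧ * deg u) ≡⟨ cong (E *_) (≡-sym (cross-swap (⟦_⟧ ∘ A) (⟦_⟧ ∘ U))) ⟩
        E * between A U ∎
        where
        open ≤-Reasoning
      half : 2 * # heavy ≤ # U
      half = *-cancelˡ-≤ m {{>-nonZero m>0}} (begin
        m * (2 * # heavy) ≡⟨ lem m (# heavy) ⟩
        2 * (# heavy * m) ≤⟨ *-monoʳ-≤ 2 heavy-edges ⟩
        2 * (E * between A U) ≤⟨ edges ⟩
        m * # U ∎)
        where
        open ≤-Reasoning
        lem : ∀ a b → a * (2 * b) ≡ 2 * (b * a)
        lem = solve-∀
      -- At least half of `U`, hence at least `2 * m` vertices, is not heavy; leaving out `A` for
      -- disjointness costs at most `m` of them.
      m≤light : m ≤ # light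
      m≤light = *-cancelˡ-≤ 2 (+-cancelˡ-≤ (2 * m) _ _ (≤-trans (≤-reflexive (lem₁ m)) (≤-trans 4m≤U
        (+-cancelˡ-≤ (# U) _ _ (begin
          # U + # U ≤⟨ +-mono-≤ U≤ U≤ ⟩
          # heavy + (m + # light) + (# heavy + (m + # light)) ≡⟨ lem₂ (# heavy) m (# light) ⟩
          2 * # heavy + (2 * m + 2 * # light) ≤⟨ +-monoˡ-≤ _ half ⟩
          # U + (2 * m + 2 * # light) ∎)))))
        where
        open ≤-Reasoning
        lem₁ : ∀ a → 2 * a + 2 * a ≡ 4 * a
        lem₁ = solve-∀
        lem₂ : ∀ a b c → a + (b + c) + (a + (b + c)) ≡ 2 * a + (2 * b + 2 * c)
        lem₂ = solve-∀
      chosen = subset-of-size light m m≤light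
      B = proj₁ chosen
      B⊆ = proj₁ (proj₂ chosen)
      #B = proj₂ (proj₂ chosen)
      disj : Disjoint A B
      disj v a with B v in eq
      ... | false = refl
      ... | true = true≢false a (not-true (∧-trueʳ {U v ∧ not (Q v)} (B⊆ v eq)))
      bound : E * between A B ≤ m * m
      bound = begin
        E * between A B ≡⟨ cong (E *_) (cross-swap (⟦_⟧ ∘ A) (⟦_⟧ ∘ B)) ⟩
        E * ∑ᶠ (λ u → ⟦ B u ⟧ * deg u) ≡⟨ ≡-sym (∑-*ˡ (allFin n) E _) ⟩
        ∑ᶠ (λ u → E * (⟦ B u ⟧ * deg u)) ≡⟨ ∑-cong (allFin n) (λ u → *-swapˡ E ⟦ B u ⟧ (deg u)) ⟩
        ∑ᶠ (λ u → ⟦ B u ⟧ * (E * deg u)) ≤⟨ ∑-weighted-≤ (allFin n) B (λ u h → ≮⇒≥ (does-false (m <? E * deg u) (not-true (∧-trueʳ {U u} (∧-trueˡ (B⊆ u h)))))) ⟩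
        # B * m ≡⟨ cong (_* m) #B ⟩
        m * m ∎
        where
        open ≤-Reasoning

  -- Colours and greedy embedding

  -- Colour true stands for edges, colour false for non-edges between distinct vertices.
  rel : ∀ {n} → Graph n → Bool → Fin n → Fin n → Bool
  rel G true v u = adj G v u
  rel G false v u = not (adj G v u) ∧ not (v =ᶠ u)

  =ᶠ-sym : ∀ {n} (v u : Fin n) → (v =ᶠ u) ≡ (u =ᶠ v)
  =ᶠ-sym v u with v Fin.≟ u
  ... | yes refl = ≡-sym (=ᶠ-refl v)
  ... | no ne = ≡-sym (false-does (u Fin.≟ v) (ne ∘ ≡-sym))

  rel-sym : ∀ {n} (G : Graph n) c v u → rel G c v u ≡ rel G c u v
  rel-sym G true v u = Graph.sym G v u
  rel-sym G false v u = cong₂ (λ a b → not a ∧ not b) (Graph.sym G v u) (=ᶠ-sym v u)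

  -- Counts the tuples with `i`-th entry in `U i` whose pairs i < j have colour `c i j`. The
  -- recursion is the greedy embedding itself: the first vertex shrinks all later candidate sets.
  -- The entries are automatically distinct, because `rel` never relates a vertex to itself. A bare
  -- colour matrix stands in for the graph, so that deleting its first index needs no proof of
  -- symmetry.
  copies : ∀ {n} → Graph n → (k : ℕ) → (Fin k → Fin k → Bool) → (Fin k → VSet n) → ℕ
  copies G zero c U = 1
  copies G (suc k) c U = ∑ᶠ λ v → ⟦ U zero v ⟧ *
    copies G k (λ i j → c (suc i) (suc j)) (λ j u → U (suc j) u ∧ rel G (c zero (suc j)) v u)

  copies-mono : ∀ {n} (G : Graph n) k c {U U′ : Fin k → VSet n} → (∀ j → U j ⊆ U′ j) →
    copies G k c U ≤ copies G k c U′
  copies-mono G zero c s = ≤-refl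
  copies-mono {n} G (suc k) c s = ∑-mono (allFin n) λ v → *-mono-≤ (⟦⟧-mono (s zero v))
    (copies-mono G k _ λ j u h → ∧-true (s (suc j) u (∧-trueˡ h)) (∧-trueʳ h))

  -- `c` is the rare colour between `A` and `B`: it has at most a fraction 1 / (E + 1) of the pairs.
  HomogeneousPair : ∀ {n} → Graph n → ℕ → ℕ → VSet n → Set
  HomogeneousPair {n} G E m W = Σ Bool λ c → Σ (VSet n) λ A → Σ (VSet n) λ B →
    A ⊆ W × B ⊆ W × Disjoint A B × # A ≡ m × # B ≡ m × suc E * between (rel G c) A B ≤ m * m

  none : ∀ {k} → (Fin k → Bool) → Bool
  none {zero} b = true
  none {suc k} b = not (b zero) ∧ none (b ∘ suc)

  none-false : ∀ {k} (b : Fin k → Bool) → none b ≡ true → ∀ j → b j ≡ false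
  none-false b h zero = not-true (∧-trueˡ h)
  none-false b h (suc j) = none-false (b ∘ suc) (∧-trueʳ {not (b zero)} h) j

  -- The union bound at a single vertex; summed over the vertices of `U zero` it bounds this set by
  -- the good vertices and all the bad ones.
  none-cover : ∀ {k} (b : Fin k → Bool) → 1 ≤ ⟦ none b ⟧ + ∑ᶠ (⟦_⟧ ∘ b)
  none-cover {zero} b = ≤-refl
  none-cover {suc k} b with b zero
  ... | true = s≤s z≤n
  ... | false = subst (λ x → 1 ≤ ⟦ none (b ∘ suc) ⟧ + x) (≡-sym (∑-tabulate k suc (⟦_⟧ ∘ b))) (none-cover (b ∘ suc))

  -- Vertices are embedded one at a time. A vertex of U zero is bad for j if it keeps less than the fraction
  -- 1 / F of U (suc j) as candidates; m bad vertices for the same j make one side of a homogeneous pair.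
  embed-or-pair : ∀ E k → Σ ℕ λ K → ∀ {n} (G : Graph n) c W (U : Fin k → VSet n) m → 0 < m →
    (∀ j → U j ⊆ W) → (∀ j → K * m ≤ # (U j)) → m ^ k ≤ copies G k c U ⊎ HomogeneousPair G E m W
  embed-or-pair E zero = 0 , λ _ _ _ _ _ _ _ _ → inj₁ ≤-refl
  embed-or-pair E (suc k) = K′ , step
    where
    -- Twice the wanted denominator, because `sparse-partner` loses a factor 2 in the Markov step.
    F = 2 * suc E
    rest = embed-or-pair E k
    K = proj₁ rest
    -- `F * K` leaves `K * m` candidates after a loss by the factor `F`, `k` pays for up to `m` bad
    -- vertices for each of the `k` later positions, and 4 provides the `4 * m` vertices required by
    -- `sparse-partner` as well as the `m` good vertices.
    K′ = F * K + (k + 4)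
    step : ∀ {n} (G : Graph n) c W (U : Fin (suc k) → VSet n) m → 0 < m →
      (∀ j → U j ⊆ W) → (∀ j → K′ * m ≤ # (U j)) → m ^ suc k ≤ copies G (suc k) c U ⊎ HomogeneousPair G E m W
    step {n} G c W U m m>0 U⊆W big = result
      where
      next : Fin n → Fin k → VSet n
      next v j u = U (suc j) u ∧ rel G (c zero (suc j)) v u
      copies′ : Fin n → ℕ
      copies′ v = copies G k (λ i j → c (suc i) (suc j)) (next v)
      bad? : ∀ v j → Dec (F * # (next v j) < # (U (suc j)))
      bad? v j = F * # (next v j) <? # (U (suc j))
      bad : Fin k → VSet n
      bad j v = U zero v ∧ does (bad? v j)
      good : VSet n
      good v = U zero v ∧ none (does ∘ bad? v)

      few-bad : ∀ j → HomogeneousPair G E m W ⊎ # (bad j) ≤ m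
      few-bad j with m ≤? # (bad j)
      ... | no ≰ = inj₂ (<⇒≤ (≰⇒> ≰))
      ... | yes ≥ =
        let (A , A⊆ , #A) = subset-of-size (bad j) m ≥
            (B , B⊆ , disj , #B , bound) = sparse-partner (rel G (c zero (suc j))) (suc E) m A (U (suc j)) m>0 #A
              (≤-trans (*-monoˡ-≤ m (≤-trans (m≤n+m 4 k) (m≤n+m (k + 4) (F * K)))) (big (suc j)))
              (λ v h → <⇒≤ (does-true (bad? v j) (∧-trueʳ {U zero v} (A⊆ v h))))
        in inj₁ (c zero (suc j) , A , B , (λ v h → U⊆W zero v (∧-trueˡ (A⊆ v h))) ,
                 (λ v h → U⊆W (suc j) v (B⊆ v h)) , disj , #A , #B , bound)

      cover : ∀ v → ⟦ U zero v ⟧ ≤ ⟦ good v ⟧ + ∑ᶠ (λ j → ⟦ bad j v ⟧)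
      cover v with U zero v
      ... | false = z≤n
      ... | true = none-cover (does ∘ bad? v)

      many-good : (∀ j → # (bad j) ≤ m) → m ≤ # good
      many-good h = +-cancelˡ-≤ (k * m) _ _ (begin
        k * m + m ≤⟨ m≤n+m (k * m + m) (F * K * m + 3 * m) ⟩
        F * K * m + 3 * m + (k * m + m) ≡⟨ lem (F * K) k m ⟩
        K′ * m ≤⟨ big zero ⟩
        # (U zero) ≤⟨ ∑-mono (allFin n) cover ⟩
        ∑ᶠ (λ v → ⟦ good v ⟧ + ∑ᶠ (λ j → ⟦ bad j v ⟧)) ≡⟨ ∑-+ (allFin n) _ _ ⟩
        # good + ∑ᶠ (λ v → ∑ᶠ (λ j → ⟦ bad j v ⟧)) ≡⟨ cong (# good +_) (∑-swap (allFin n) (allFin k) (λ v j → ⟦ bad j v ⟧)) ⟩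
        # good + ∑ᶠ (λ j → # (bad j)) ≤⟨ +-monoʳ-≤ (# good) (∑-mono (allFin k) h) ⟩
        # good + ∑ᶠ {k} (λ _ → m) ≡⟨ cong (# good +_) (trans (∑-const (allFin k) m) (cong (_* m) (length-tabulate {n = k} id))) ⟩
        # good + k * m ≡⟨ +-comm (# good) _ ⟩
        k * m + # good ∎)
        where
        open ≤-Reasoning
        lem : ∀ a b c → a * c + 3 * c + (b * c + c) ≡ (a + (b + 4)) * c
        lem = solve-∀

      next-big : ∀ v → good v ≡ true → ∀ j → K * m ≤ # (next v j)
      next-big v h j = *-cancelˡ-≤ F (begin
        F * (K * m) ≡⟨ ≡-sym (*-assoc F K m) ⟩
        F * K * m ≤⟨ *-monoˡ-≤ m (m≤m+n (F * K) (k + 4)) ⟩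
        K′ * m ≤⟨ big (suc j) ⟩
        # (U (suc j)) ≤⟨ ≮⇒≥ (does-false (bad? v j) (none-false (does ∘ bad? v) (∧-trueʳ {U zero v} h) j)) ⟩
        F * # (next v j) ∎)
        where open ≤-Reasoning

      extend : ∀ v → HomogeneousPair G E m W ⊎ (good v ≡ true → m ^ k ≤ copies′ v)
      extend v with good v in eq
      ... | false = inj₂ λ ()
      ... | true with proj₂ rest G (λ i j → c (suc i) (suc j)) W (next v) m m>0
                        (λ j u h → U⊆W (suc j) u (∧-trueˡ h)) (next-big v eq)
      ...   | inj₁ x = inj₂ λ _ → x
      ...   | inj₂ p = inj₁ p

      result : m ^ suc k ≤ copies G (suc k) c U ⊎ HomogeneousPair G E m W
      result with fin-choice few-bad | fin-choice extend
      ... | inj₁ p | _ = inj₂ p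
      ... | inj₂ _ | inj₁ p = inj₂ p
      ... | inj₂ b | inj₂ x = inj₁ (begin
        m * m ^ k ≤⟨ *-monoˡ-≤ (m ^ k) (many-good b) ⟩
        # good * m ^ k ≤⟨ ∑-weighted-≥ (allFin n) good x ⟩
        ∑ᶠ (λ v → ⟦ good v ⟧ * copies′ v) ≤⟨ ∑-mono (allFin n) (λ v → *-monoˡ-≤ (copies′ v) (⟦⟧-mono (∧-trueˡ {U zero v}))) ⟩
        ∑ᶠ (λ v → ⟦ U zero v ⟧ * copies′ v) ∎)
        where open ≤-Reasoning

  -- Homogeneous sets

  -- Each doubling adds at most 2 m² pairs of colour c, which the summand 2 m² on the left absorbs: the bound
  -- on the number of these pairs only doubles with a while their maximal possible number quadruples.
  HomogeneousSet : ∀ {n} → Graph n → Bool → ℕ → ℕ → VSet n → Set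
  HomogeneousSet {n} G c a m W = Σ (VSet n) λ S → S ⊆ W × # S ≡ 2 ^ a * m ×
    between (rel G c) S S + 2 * (m * m) ≤ 3 * 2 ^ a * (m * m)

  module _ {n} (G : Graph n) (c : Bool) (m : ℕ) where

    -- Any `m` vertices will do: the trivial bound m² together with the summand 2m² is exactly the
    -- right side for a = 0, which fixes the constant 3.
    homogeneous-zero : ∀ {W} → m ≤ # W → HomogeneousSet G c 0 m W
    homogeneous-zero {W} h =
      let (S , S⊆ , #S) = subset-of-size W m h in
      S , S⊆ , trans #S (≡-sym (+-identityʳ m)) ,
      ≤-trans (+-monoˡ-≤ _ (≤-trans (cross-≤ (rel G c) (⟦_⟧ ∘ S) (⟦_⟧ ∘ S)) (≤-reflexive (cong₂ _*_ #S #S))))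
              (≤-reflexive (lem (m * m)))
      where
      lem : ∀ x → x + 2 * x ≡ 3 * 1 * x
      lem = solve-∀

    homogeneous-suc : ∀ a {A B W} → A ⊆ W → B ⊆ W → Disjoint A B → between (rel G c) A B ≤ m * m →
      HomogeneousSet G c a m A → HomogeneousSet G c a m B → HomogeneousSet G c (suc a) m W
    homogeneous-suc a A⊆ B⊆ d few (X , X⊆ , #X , hX) (Y , Y⊆ , #Y , hY) =
      X ∪ Y , ∪-⊆ (λ v h → A⊆ v (X⊆ v h)) (λ v h → B⊆ v (Y⊆ v h)) ,
      trans (#-∪ X Y XY) (trans (cong₂ _+_ #X #Y) (lem₁ (2 ^ a) m)) , (begin
        D (X ∪ Y) (X ∪ Y) + 2 * (m * m) ≡⟨ cong (_+ 2 * (m * m)) (between-∪ (rel G c) (rel-sym G c) X Y XY) ⟩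
        D X X + D Y Y + 2 * D X Y + 2 * (m * m) ≤⟨ +-monoˡ-≤ _ (+-monoʳ-≤ (D X X + D Y Y) (*-monoʳ-≤ 2 XY-few)) ⟩
        D X X + D Y Y + 2 * (m * m) + 2 * (m * m) ≡⟨ lem₂ (D X X) (D Y Y) (m * m) ⟩
        (D X X + 2 * (m * m)) + (D Y Y + 2 * (m * m)) ≤⟨ +-mono-≤ hX hY ⟩
        3 * 2 ^ a * (m * m) + 3 * 2 ^ a * (m * m) ≡⟨ lem₃ (2 ^ a) (m * m) ⟩
        3 * 2 ^ suc a * (m * m) ∎)
      where
      open ≤-Reasoning
      D = between (rel G c)
      XY : Disjoint X Y
      XY v h with Y v in eq
      ... | false = refl
      ... | true = true≢false (Y⊆ v eq) (d v (X⊆ v h))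
      -- The bound concerns the absolute number of pairs, so it passes from `A` and `B` to arbitrary
      -- subsets without loss.
      XY-few : D X Y ≤ m * m
      XY-few = ≤-trans (cross-mono (rel G c) (λ v → ⟦⟧-mono (X⊆ v)) (λ v → ⟦⟧-mono (Y⊆ v))) few
      lem₁ : ∀ x y → x * y + x * y ≡ 2 * x * y
      lem₁ = solve-∀
      lem₂ : ∀ x y z → x + y + 2 * z + 2 * z ≡ (x + 2 * z) + (y + 2 * z)
      lem₂ = solve-∀
      lem₃ : ∀ x y → 3 * x * y + 3 * x * y ≡ 3 * (2 * x) * y
      lem₃ = solve-∀

  -- Induction on both targets, as for Ramsey numbers. If edges are rare in the pair, both sides are
  -- searched with targets (a, suc b): two sets with rare edges are joined, and a set with rare
  -- non-edges on either side is already the answer. Rare non-edges are symmetric. A target 0 is met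
  -- by any `m` vertices. The seed size `m` is the same at all levels; only the required size of `W`
  -- grows.
  homogeneous-set : ∀ r a b → Σ ℕ λ K → 0 < K × (∀ {n} (G : Graph n) c W m → 0 < m →
    copies G r c (λ _ _ → true) < m ^ r → K * m ≤ # W → HomogeneousSet G true a m W ⊎ HomogeneousSet G false b m W)
  homogeneous-set r zero b = 1 , s≤s z≤n , λ G c W m _ _ h → inj₁ (homogeneous-zero G true m (subst (_≤ # W) (+-identityʳ m) h))
  homogeneous-set r (suc a) zero = 1 , s≤s z≤n , λ G c W m _ _ h → inj₂ (homogeneous-zero G false m (subst (_≤ # W) (+-identityʳ m) h))
  homogeneous-set r (suc a) (suc b) = suc (KB * K) , s≤s z≤n , step
    where
    left = homogeneous-set r a (suc b)
    right = homogeneous-set r (suc a) b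
    K₁ = proj₁ left
    K₂ = proj₁ right
    -- The colour of the pair is known only after it has been found, so its sides must be large
    -- enough for both recursive calls.
    K = K₁ + K₂
    -- The factor K * K keeps the pair homogeneous after shrinking both sides from K * m to order m.
    pair = embed-or-pair (K * K) r
    KB = proj₁ pair
    K>0 : 0 < K
    K>0 = ≤-trans (proj₁ (proj₂ left)) (m≤m+n K₁ K₂)
    step : ∀ {n} (G : Graph n) c W m → 0 < m → copies G r c (λ _ _ → true) < m ^ r → suc (KB * K) * m ≤ # W →
      HomogeneousSet G true (suc a) m W ⊎ HomogeneousSet G false (suc b) m W
    step G c W m m>0 few big with proj₂ pair G c W (λ _ → W) (K * m) Km>0 (λ _ _ h → h) (λ _ → KB-big)
      where
      Km>0 : 0 < K * m
      Km>0 = *-mono-≤ K>0 m>0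
      KB-big : KB * (K * m) ≤ # W
      KB-big = ≤-trans (≤-reflexive (≡-sym (*-assoc KB K m))) (≤-trans (m≤n+m (KB * K * m) m) big)
    -- The embedding runs at scale `K * m`, so it would give at least (K m)^r ≥ m^r copies, contrary
    -- to `few`.
    ... | inj₁ many = ⊥-elim (<-irrefl refl (<-≤-trans few (≤-trans (^-monoˡ-≤ r (m≤n*m m K {{>-nonZero K>0}}))
            (≤-trans many (copies-mono G r c (λ _ _ _ → refl))))))
    ... | inj₂ (col , A , B , A⊆ , B⊆ , disj , #A , #B , sparse) = combine col cross≤
      where
      cross≤ : between (rel G col) A B ≤ m * m
      cross≤ = *-cancelˡ-≤ (K * K) {{>-nonZero (*-mono-≤ K>0 K>0)}} (begin
        K * K * between (rel G col) A B ≤⟨ *-monoˡ-≤ _ (n≤1+n (K * K)) ⟩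
        suc (K * K) * between (rel G col) A B ≤⟨ sparse ⟩
        K * m * (K * m) ≡⟨ lem K m ⟩
        K * K * (m * m) ∎)
        where
        open ≤-Reasoning
        lem : ∀ x y → x * y * (x * y) ≡ x * x * (y * y)
        lem = solve-∀
      widen : ∀ c a {V} → V ⊆ W → HomogeneousSet G c a m V → HomogeneousSet G c a m W
      widen _ _ V⊆ (S , S⊆ , rest) = S , (λ v h → V⊆ v (S⊆ v h)) , rest
      big₁ : ∀ V → # V ≡ K * m → K₁ * m ≤ # V
      big₁ V #V = subst (K₁ * m ≤_) {y = # V} (≡-sym #V) (*-monoˡ-≤ m (m≤m+n K₁ K₂))
      big₂ : ∀ V → # V ≡ K * m → K₂ * m ≤ # V
      big₂ V #V = subst (K₂ * m ≤_) {y = # V} (≡-sym #V) (*-monoˡ-≤ m (m≤n+m K₂ K₁))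
      combine : ∀ col → between (rel G col) A B ≤ m * m → HomogeneousSet G true (suc a) m W ⊎ HomogeneousSet G false (suc b) m W
      combine true x with proj₂ (proj₂ left) G c A m m>0 few (big₁ A #A) | proj₂ (proj₂ left) G c B m m>0 few (big₁ B #B)
      ... | inj₂ S | _ = inj₂ (widen false (suc b) A⊆ S)
      ... | inj₁ _ | inj₂ S = inj₂ (widen false (suc b) B⊆ S)
      ... | inj₁ S | inj₁ T = inj₁ (homogeneous-suc G true m a A⊆ B⊆ disj x S T)
      combine false x with proj₂ (proj₂ right) G c A m m>0 few (big₂ A #A) | proj₂ (proj₂ right) G c B m m>0 few (big₂ B #B)
      ... | inj₁ S | _ = inj₁ (widen true (suc a) A⊆ S)
      ... | inj₂ _ | inj₁ S = inj₁ (widen true (suc a) B⊆ S)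
      ... | inj₂ S | inj₂ T = inj₂ (homogeneous-suc G false m b A⊆ B⊆ disj x S T)

  -- Counting copies by their embeddings

  size≡# : ∀ {n} (S : Subset n) → size S ≡ # (lookup S)
  size≡# {n} S = count≡∑ (lookup S) (allFin n)

  ∑-∈ : ∀ {A : Set} {x : A} {xs} (f : A → ℕ) → x ∈ xs → f x ≤ ∑ xs f
  ∑-∈ f (here refl) = m≤m+n _ _
  ∑-∈ f (there p) = ≤-trans (∑-∈ f p) (m≤n+m _ _)

  any-true : ∀ {A : Set} {x : A} {xs} (p : A → Bool) → x ∈ xs → p x ≡ true → any p xs ≡ true
  any-true p (here refl) h rewrite h = refl
  any-true {xs = y ∷ _} p (there m) h with p y
  ... | true = refl
  ... | false = any-true p m h

  -- A disjunction, because the entrywise condition of isIsoOnto uses an operator local to its definition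
  -- and cannot be written down; a failing entry can still be inspected.
  all-true-or : ∀ {A : Set} (p : A → Bool) xs → all p xs ≡ true ⊎ Σ A λ x → p x ≡ false
  all-true-or p [] = inj₁ refl
  all-true-or p (x ∷ xs) with p x in eq
  ... | false = inj₂ (x , eq)
  ... | true = all-true-or p xs

  ∈-allVecs : ∀ {n} k (f : Vec (Fin n) k) → f ∈ allVecs k n
  ∈-allVecs zero []ᵥ = here refl
  ∈-allVecs (suc k) (v ∷ᵥ f) = ∈-concatMap⁺ _ (lose (∈-allVecs k f) (∈-map⁺ (_∷ᵥ f) (∈-allFin v)))

  ∈-allSubsets : ∀ {n} (S : Subset n) → S ∈ allSubsets n
  ∈-allSubsets []ᵥ = here refl
  ∈-allSubsets (b ∷ᵥ S) = ∈-concatMap⁺ _ (lose (∈-allSubsets S) (mem b))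
    where
    mem : ∀ b → (b ∷ᵥ S) ∈ (true ∷ᵥ S) ∷ [ false ∷ᵥ S ]
    mem true = here refl
    mem false = there (here refl)

  within : ∀ {n k} → VSet n → Vec (Fin n) k → Bool
  within P []ᵥ = true
  within P (v ∷ᵥ f) = P v ∧ within P f

  within-true : ∀ {n k} (P : VSet n) (f : Vec (Fin n) k) → (∀ j → P (lookup f j) ≡ true) → within P f ≡ true
  within-true P []ᵥ h = refl
  within-true P (v ∷ᵥ f) h = ∧-true (h zero) (within-true P f (h ∘ suc))

  -- `allVecs` runs through the tails outside and the heads inside; exchanging the sums puts the
  -- head first, as in the recursion of `copies`.
  ∑-allVecs-suc : ∀ {n} k (g : Vec (Fin n) (suc k) → ℕ) →
    ∑ (allVecs (suc k) n) g ≡ ∑ᶠ λ v → ∑ (allVecs k n) λ f → g (v ∷ᵥ f)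
  ∑-allVecs-suc {n} k g = trans (∑-concatMap _ (allVecs k n) g)
    (trans (∑-cong (allVecs k n) λ f → ∑-map (_∷ᵥ f) (allFin n) g) (∑-swap (allVecs k n) (allFin n) _))

  ∑-within : ∀ {n} k (P : VSet n) → ∑ (allVecs k n) (⟦_⟧ ∘ within P) ≡ # P ^ k
  ∑-within zero P = refl
  ∑-within {n} (suc k) P = begin
    ∑ (allVecs (suc k) n) (⟦_⟧ ∘ within P)
      ≡⟨ ∑-allVecs-suc k _ ⟩
    ∑ᶠ (λ v → ∑ (allVecs k n) λ f → ⟦ P v ∧ within P f ⟧)
      ≡⟨ ∑-cong (allFin n) (λ v → trans (∑-cong (allVecs k n) λ f → ⟦∧⟧ (P v) (within P f)) (∑-*ˡ (allVecs k n) ⟦ P v ⟧ _)) ⟩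
    ∑ᶠ (λ v → ⟦ P v ⟧ * ∑ (allVecs k n) (⟦_⟧ ∘ within P))
      ≡⟨ ∑-*ʳ (allFin n) _ (⟦_⟧ ∘ P) ⟩
    # P * ∑ (allVecs k n) (⟦_⟧ ∘ within P)
      ≡⟨ cong (# P *_) (∑-within k P) ⟩
    # P ^ suc k ∎
    where open ≡-Reasoning

  embeds : ∀ {n} → Graph n → (k : ℕ) → (Fin k → Fin k → Bool) → (Fin k → VSet n) → Vec (Fin n) k → Bool
  embeds G zero c U []ᵥ = true
  embeds G (suc k) c U (v ∷ᵥ f) = U zero v ∧
    embeds G k (λ i j → c (suc i) (suc j)) (λ j u → U (suc j) u ∧ rel G (c zero (suc j)) v u) f

  copies≡∑-embeds : ∀ {n} (G : Graph n) k c U → copies G k c U ≡ ∑ (allVecs k n) (⟦_⟧ ∘ embeds G k c U)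
  copies≡∑-embeds G zero c U = refl
  copies≡∑-embeds {n} G (suc k) c U = trans
    (∑-cong (allFin n) λ v → trans (cong (⟦ U zero v ⟧ *_) (copies≡∑-embeds G k _ _))
      (trans (≡-sym (∑-*ˡ (allVecs k n) ⟦ U zero v ⟧ _)) (∑-cong (allVecs k n) λ f → ≡-sym (⟦∧⟧ (U zero v) _))))
    (≡-sym (∑-allVecs-suc k _))

  embeds-sound : ∀ {n} (G : Graph n) k c U f → embeds G k c U f ≡ true →
    (∀ j → U j (lookup f j) ≡ true) × (∀ i j → i Fin.< j → rel G (c i j) (lookup f i) (lookup f j) ≡ true)
  embeds-sound G zero c U []ᵥ h = (λ ()) , λ ()
  embeds-sound G (suc k) c U (v ∷ᵥ f) h with embeds-sound G k _ _ f (∧-trueʳ {U zero v} h)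
  ... | (inU , ok) =
    (λ { zero → ∧-trueˡ h ; (suc j) → ∧-trueˡ (inU j) }) ,
    (λ { zero (suc j) _ → ∧-trueʳ {U (suc j) (lookup f j)} (inU j) ; (suc i) (suc j) (s≤s lt) → ok i j lt })

  rel⇒≢ : ∀ {n} (G : Graph n) c {v u} → rel G c v u ≡ true → v ≢ u
  rel⇒≢ G true {v} h refl = true≢false h (irrefl G v)
  rel⇒≢ G false {v} h refl = true≢false (=ᶠ-refl v) (not-true (∧-trueʳ {not (adj G v v)} h))

  rel⇒=ᵇ : ∀ {n} (G : Graph n) c {v u} → rel G c v u ≡ true → (c =ᵇ adj G v u) ≡ true
  rel⇒=ᵇ G true h = h
  rel⇒=ᵇ G false {v} {u} h rewrite not-true {adj G v u} (∧-trueˡ h) = refl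

  image : ∀ {n k} → Vec (Fin n) k → VSet n
  image []ᵥ u = false
  image (v ∷ᵥ f) = (v =ᶠ_) ∪ image f

  ∈-image : ∀ {n k} (f : Vec (Fin n) k) j → image f (lookup f j) ≡ true
  ∈-image (v ∷ᵥ f) zero rewrite =ᶠ-refl v = refl
  ∈-image (v ∷ᵥ f) (suc j) with v =ᶠ lookup f j
  ... | true = refl
  ... | false = ∈-image f j

  image-∈ : ∀ {n k} (f : Vec (Fin n) k) u → image f u ≡ true → Σ (Fin k) λ j → lookup f j ≡ u
  image-∈ (v ∷ᵥ f) u h with v Fin.≟ u
  ... | yes p = zero , p
  ... | no _ = let (j , p) = image-∈ f u h in suc j , p

  #-image : ∀ {n k} (f : Vec (Fin n) k) → (∀ i j → i Fin.< j → lookup f i ≢ lookup f j) → # (image f) ≡ k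
  #-image {n} []ᵥ h = ∑-zero (allFin n)
  #-image {n} (v ∷ᵥ f) h = trans (#-∪ (v =ᶠ_) (image f) disj) (cong₂ _+_
      (trans (∑-cong (allFin n) λ u → ≡-sym (*-identityʳ ⟦ v =ᶠ u ⟧)) (∑ᶠ-δ v (λ _ → 1)))
      (#-image f λ i j lt → h (suc i) (suc j) (s≤s lt)))
    where
    disj : Disjoint (v =ᶠ_) (image f)
    disj u p with image f u in eq
    ... | false = refl
    ... | true = let (j , q) = image-∈ f u eq in
      ⊥-elim (h zero (suc j) (s≤s z≤n) (trans (does-true (v Fin.≟ u) p) (≡-sym q)))

  module _ {r n : ℕ} (H : Graph r) (G : Graph n) where

    -- No entry of the check can fail: on the diagonal both adjacencies are false, and off it `rel`
    -- gives the right adjacency and, being irreflexive, also distinct images.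
    embedding⇒iso : ∀ (S : Subset n) f → (∀ j → lookup S (lookup f j) ≡ true) →
      (∀ i j → i ≢ j → rel G (adj H i j) (lookup f i) (lookup f j) ≡ true) → isIsoOnto H G S f ≡ true
    embedding⇒iso S f inS ok with all-true-or (λ a → lookup S (lookup f a)) (allFin r)
    ... | inj₂ (a , h) = true≢false (inS a) h
    ... | inj₁ h rewrite h with all-true-or _ (allFin r)
    ...   | inj₁ h′ = h′
    ...   | inj₂ (a , ha) with all-true-or _ (allFin r)
    ...     | inj₁ h′ = true≢false h′ ha
    ...     | inj₂ (b , hb) with a Fin.≟ b
    ...       | yes refl rewrite irrefl H a | irrefl G (lookup f a) = true≢false refl hb
    ...       | no a≢b rewrite false-does (lookup f a Fin.≟ lookup f b) (rel⇒≢ G (adj H a b) (ok a b a≢b)) =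
      true≢false (rel⇒=ᵇ G (adj H a b) (ok a b a≢b)) hb

    embedding⇒copy : ∀ f → embeds G r (adj H) (λ _ _ → true) f ≡ true →
      Σ (Subset n) λ S → inducesCopy H G S ≡ true × within (lookup S) f ≡ true
    embedding⇒copy f h = S , ind , within-true (lookup S) f inS
      where
      S = Vec.tabulate (image f)
      sound = proj₂ (embeds-sound G r (adj H) _ f h)
      inS : ∀ j → lookup S (lookup f j) ≡ true
      inS j = trans (lookup∘tabulate (image f) (lookup f j)) (∈-image f j)
      ok : ∀ i j → i ≢ j → rel G (adj H i j) (lookup f i) (lookup f j) ≡ true
      ok i j i≢j with Fin.<-cmp i j
      ... | tri< lt _ _ = sound i j lt
      ... | tri≈ _ eq _ = ⊥-elim (i≢j eq)
      ... | tri> _ _ gt rewrite Graph.sym H i j = trans (rel-sym G (adj H j i) _ _) (sound j i gt)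
      |S| : size S ≡ r
      |S| = trans (size≡# S) (trans (#-cong (lookup∘tabulate (image f)))
        (#-image f λ i j lt → rel⇒≢ G (adj H i j) (sound i j lt)))
      ind : inducesCopy H G S ≡ true
      ind = ∧-true (trans (cong (_≡ᵇ r) |S|) (≡ᵇ-refl r)) (any-true (isIsoOnto H G S) (∈-allVecs r f) (embedding⇒iso S f inS ok))
        where
        ≡ᵇ-refl : ∀ k → (k ≡ᵇ k) ≡ true
        ≡ᵇ-refl zero = refl
        ≡ᵇ-refl (suc k) = ≡ᵇ-refl k

    -- Each embedding is charged to an induced copy that contains its image. A set of r vertices
    -- contains all entries of only r^r tuples, a crude bound in place of r! that suffices for a
    -- constant depending on r.
    copies≤kH : copies G r (adj H) (λ _ _ → true) ≤ kH H G * r ^ r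
    copies≤kH = begin
      copies G r (adj H) (λ _ _ → true)
        ≡⟨ copies≡∑-embeds G r (adj H) _ ⟩
      ∑ (allVecs r n) (⟦_⟧ ∘ embeds G r (adj H) (λ _ _ → true))
        ≤⟨ ∑-mono (allVecs r n) charge ⟩
      ∑ (allVecs r n) (λ f → ∑ (allSubsets n) λ S → ⟦ inducesCopy H G S ⟧ * ⟦ within (lookup S) f ⟧)
        ≡⟨ ∑-swap (allVecs r n) (allSubsets n) _ ⟩
      ∑ (allSubsets n) (λ S → ∑ (allVecs r n) λ f → ⟦ inducesCopy H G S ⟧ * ⟦ within (lookup S) f ⟧)
        ≡⟨ ∑-cong (allSubsets n) (λ S → trans (∑-*ˡ (allVecs r n) ⟦ inducesCopy H G S ⟧ _)
             (cong (⟦ inducesCopy H G S ⟧ *_) (∑-within r (lookup S)))) ⟩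
      ∑ (allSubsets n) (λ S → ⟦ inducesCopy H G S ⟧ * # (lookup S) ^ r)
        ≤⟨ ∑-weighted-≤ (allSubsets n) (inducesCopy H G) (λ S h → ≤-reflexive (cong (_^ r) (|copy| S h))) ⟩
      ∑ (allSubsets n) (⟦_⟧ ∘ inducesCopy H G) * r ^ r
        ≡⟨ cong (_* r ^ r) (≡-sym (count≡∑ (inducesCopy H G) (allSubsets n))) ⟩
      kH H G * r ^ r ∎
      where
      open ≤-Reasoning
      |copy| : ∀ S → inducesCopy H G S ≡ true → # (lookup S) ≡ r
      |copy| S h = trans (≡-sym (size≡# S)) (≡ᵇ⇒≡ (size S) r (subst T (≡-sym (∧-trueˡ h)) tt))
      charge : ∀ f → ⟦ embeds G r (adj H) (λ _ _ → true) f ⟧ ≤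
        ∑ (allSubsets n) λ S → ⟦ inducesCopy H G S ⟧ * ⟦ within (lookup S) f ⟧
      charge f with embeds G r (adj H) (λ _ _ → true) f in eq
      ... | false = z≤n
      ... | true = let (S , h₁ , h₂) = embedding⇒copy f eq in
        ≤-trans (≤-reflexive (≡-sym (cong₂ (λ a b → ⟦ a ⟧ * ⟦ b ⟧) h₁ h₂)))
          (∑-∈ (λ S → ⟦ inducesCopy H G S ⟧ * ⟦ within (lookup S) f ⟧) (∈-allSubsets S))

  -- Edges inside a set

  nC2 : ∀ n → 2 * (n C 2) + n ≡ n * n
  nC2 zero = refl
  nC2 (suc n) = begin
    2 * (suc n C 2) + suc n ≡⟨ cong (λ x → 2 * x + suc n) (≡-sym (nCk+nC[k+1]≡[n+1]C[k+1] n 1)) ⟩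
    2 * (n C 1 + n C 2) + suc n ≡⟨ cong (λ x → 2 * (x + n C 2) + suc n) (nC1≡n n) ⟩
    2 * (n + n C 2) + suc n ≡⟨ lem₁ n (n C 2) ⟩
    2 * n + 1 + (2 * (n C 2) + n) ≡⟨ cong (2 * n + 1 +_) (nC2 n) ⟩
    2 * n + 1 + n * n ≡⟨ lem₂ n ⟩
    suc n * suc n ∎
    where
    open ≡-Reasoning
    lem₁ : ∀ x y → 2 * (x + y) + (1 + x) ≡ 2 * x + 1 + (2 * y + x)
    lem₁ = solve-∀
    lem₂ : ∀ x → 2 * x + 1 + x * x ≡ (1 + x) * (1 + x)
    lem₂ = solve-∀

  lt : ∀ {n} → Fin n → Fin n → Bool
  lt i j = does (toℕ i <? toℕ j)

  -- Connects `e`, which lists each pair once with i < j, to the ordered count `between`: off the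
  -- diagonal exactly one of `lt i j` and `lt j i` holds.
  ∑-symmetric : ∀ {n} (w : Fin n → Fin n → ℕ) → (∀ i j → w i j ≡ w j i) → (∀ i → w i i ≡ 0) →
    2 * ∑ᶠ (λ i → ∑ᶠ λ j → ⟦ lt i j ⟧ * w i j) ≡ ∑ᶠ (λ i → ∑ᶠ λ j → w i j)
  ∑-symmetric {n} w s z = begin
    2 * up ≡⟨ cong (up +_) (+-identityʳ up) ⟩
    up + up ≡⟨ cong (up +_) (∑-swap (allFin n) (allFin n) _) ⟩
    up + ∑ᶠ (λ j → ∑ᶠ λ i → ⟦ lt i j ⟧ * w i j) ≡⟨ ≡-sym (∑-+ (allFin n) _ _) ⟩
    ∑ᶠ (λ i → ∑ᶠ (λ j → ⟦ lt i j ⟧ * w i j) + ∑ᶠ (λ j → ⟦ lt j i ⟧ * w j i))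
      ≡⟨ ∑-cong (allFin n) (λ i → trans (≡-sym (∑-+ (allFin n) _ _)) (∑-cong (allFin n) (pt i))) ⟩
    ∑ᶠ (λ i → ∑ᶠ λ j → w i j) ∎
    where
    open ≡-Reasoning
    up = ∑ᶠ (λ i → ∑ᶠ λ j → ⟦ lt i j ⟧ * w i j)
    pt : ∀ i j → ⟦ lt i j ⟧ * w i j + ⟦ lt j i ⟧ * w j i ≡ w i j
    pt i j with Fin.<-cmp i j
    ... | tri< a _ b rewrite true-does (toℕ i <? toℕ j) a | false-does (toℕ j <? toℕ i) b =
      trans (+-identityʳ _) (+-identityʳ _)
    ... | tri> b _ a rewrite true-does (toℕ j <? toℕ i) a | false-does (toℕ i <? toℕ j) b =
      trans (+-identityʳ _) (s j i)
    ... | tri≈ b refl _ rewrite false-does (toℕ i <? toℕ i) b = ≡-sym (z i)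

  module _ {n} (G : Graph n) where

    2*e≡between : ∀ (U : Subset n) → 2 * e G U ≡ between (rel G true) (lookup U) (lookup U)
    2*e≡between U = begin
      2 * e G U
        ≡⟨ cong (2 *_) (trans (count≡∑ _ (pairs n)) (trans (∑-concatMap _ (allFin n) _) (∑-cong (allFin n) λ i →
             trans (∑-map (i ,_) (filterᵇ (lt i) (allFin n)) _) (∑-filterᵇ (lt i) (allFin n) _)))) ⟩
      2 * ∑ᶠ (λ i → ∑ᶠ λ j → ⟦ lt i j ⟧ * w i j)
        ≡⟨ ∑-symmetric w w-sym w-irrefl ⟩
      ∑ᶠ (λ i → ∑ᶠ λ j → w i j)
        ≡⟨ ∑-cong (allFin n) (λ i → trans (∑-cong (allFin n) λ j →
             trans (⟦∧⟧ (lookup U i) _) (cong (⟦ lookup U i ⟧ *_) (⟦∧⟧ (lookup U j) (adj G i j))))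
             (∑-*ˡ (allFin n) ⟦ lookup U i ⟧ _)) ⟩
      between (rel G true) (lookup U) (lookup U) ∎
      where
      open ≡-Reasoning
      w : Fin n → Fin n → ℕ
      w i j = ⟦ lookup U i ∧ lookup U j ∧ adj G i j ⟧
      w-sym : ∀ i j → w i j ≡ w j i
      w-sym i j rewrite Graph.sym G i j with lookup U i | lookup U j
      ... | true | true = refl
      ... | true | false = refl
      ... | false | true = refl
      ... | false | false = refl
      w-irrefl : ∀ i → w i i ≡ 0
      w-irrefl i rewrite irrefl G i with lookup U i
      ... | true = refl
      ... | false = refl

    -- The summand `# S` is the diagonal, which belongs to neither colour.
    between-complement : ∀ S → between (rel G true) S S + between (rel G false) S S + # S ≡ # S * # S
    between-complement S = begin
      between (rel G true) S S + between (rel G false) S S + # S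
        ≡⟨ cong (_+ # S) (≡-sym (∑-+ (allFin n) _ _)) ⟩
      ∑ᶠ (λ v → ⟦ S v ⟧ * A v + ⟦ S v ⟧ * B v) + # S
        ≡⟨ ≡-sym (∑-+ (allFin n) _ _) ⟩
      ∑ᶠ (λ v → ⟦ S v ⟧ * A v + ⟦ S v ⟧ * B v + ⟦ S v ⟧)
        ≡⟨ ∑-cong (allFin n) row ⟩
      ∑ᶠ (λ v → ⟦ S v ⟧ * # S)
        ≡⟨ ∑-*ʳ (allFin n) (# S) _ ⟩
      # S * # S ∎
      where
      open ≡-Reasoning
      A B : Fin n → ℕ
      A v = ∑ᶠ λ u → ⟦ S u ⟧ * ⟦ rel G true v u ⟧
      B v = ∑ᶠ λ u → ⟦ S u ⟧ * ⟦ rel G false v u ⟧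
      pt : ∀ v u → ⟦ S u ⟧ * ⟦ rel G true v u ⟧ + ⟦ S u ⟧ * ⟦ rel G false v u ⟧ + ⟦ v =ᶠ u ⟧ * ⟦ S u ⟧ ≡ ⟦ S u ⟧
      pt v u with S u
      ... | false = *-zeroʳ ⟦ v =ᶠ u ⟧
      ... | true with v Fin.≟ u
      ...   | yes refl rewrite irrefl G v = refl
      ...   | no _ with adj G v u
      ...     | true = refl
      ...     | false = refl
      row : ∀ v → ⟦ S v ⟧ * A v + ⟦ S v ⟧ * B v + ⟦ S v ⟧ ≡ ⟦ S v ⟧ * # S
      row v with S v in eq
      ... | false = refl
      ... | true = begin
        A v + 0 + (B v + 0) + 1 ≡⟨ cong₂ (λ x y → x + y + 1) (+-identityʳ (A v)) (+-identityʳ (B v)) ⟩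
        A v + B v + 1 ≡⟨ cong (A v + B v +_) (≡-sym (trans (∑ᶠ-δ v (⟦_⟧ ∘ S)) (cong ⟦_⟧ eq))) ⟩
        A v + B v + ∑ᶠ (λ u → ⟦ v =ᶠ u ⟧ * ⟦ S u ⟧) ≡⟨ cong (_+ ∑ᶠ (λ u → ⟦ v =ᶠ u ⟧ * ⟦ S u ⟧)) (≡-sym (∑-+ (allFin n) _ _)) ⟩
        ∑ᶠ (λ u → ⟦ S u ⟧ * ⟦ rel G true v u ⟧ + ⟦ S u ⟧ * ⟦ rel G false v u ⟧) + ∑ᶠ (λ u → ⟦ v =ᶠ u ⟧ * ⟦ S u ⟧) ≡⟨ ≡-sym (∑-+ (allFin n) _ _) ⟩
        ∑ᶠ (λ u → ⟦ S u ⟧ * ⟦ rel G true v u ⟧ + ⟦ S u ⟧ * ⟦ rel G false v u ⟧ + ⟦ v =ᶠ u ⟧ * ⟦ S u ⟧) ≡⟨ ∑-cong (allFin n) (pt v) ⟩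
        # S ≡⟨ ≡-sym (+-identityʳ (# S)) ⟩
        # S + 0 ∎

  -- Greedy partition

  -- Label `zero` stays the remainder, and label `suc zero` becomes free for the newly removed set.
  lift : ∀ {k} → Fin (suc k) → Fin (suc (suc k))
  lift zero = zero
  lift (suc i) = suc (suc i)

  -- Before each of the k removals at least M + t vertices are left, which is all that the search
  -- demands. The clause that `g` is `zero` outside `W` keeps the labels of the recursive call away
  -- from the set just removed, and later makes two such labellings compatible.
  greedy-partition : ∀ {n} (Good : VSet n → Set) M t →
    (∀ W → M + t ≤ # W → Σ (VSet n) λ S → S ⊆ W × # S ≡ M × Good S) →
    ∀ k W → k * M + t ≤ # W → Σ (Fin n → Fin (suc k)) λ g →
      (∀ v → W v ≡ false → g v ≡ zero) ×
      # (λ v → W v ∧ (g v =ᶠ zero)) + k * M ≡ # W ×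
      (∀ i → Σ (VSet n) λ S → # S ≡ M × Good S × (∀ v → (g v =ᶠ suc i) ≡ S v))
  greedy-partition Good M t find zero W big =
    (λ _ → zero) , (λ _ _ → refl) , trans (+-identityʳ _) (#-cong λ v → ∧-identityʳ (W v)) , λ ()
  greedy-partition {n} Good M t find (suc k) W big = g′ , outside , remainder , parts
    where
    found = find W (≤-trans (+-monoˡ-≤ t (m≤m+n M (k * M))) big)
    S = proj₁ found
    S⊆ = proj₁ (proj₂ found)
    #S = proj₁ (proj₂ (proj₂ found))
    #W : # W ≡ M + # (W ∖ S)
    #W = trans (#-∖ W S S⊆) (cong (_+ # (W ∖ S)) #S)
    rest = greedy-partition Good M t find k (W ∖ S)
      (+-cancelˡ-≤ M _ _ (≤-trans (≤-reflexive (≡-sym (+-assoc M (k * M) t))) (subst (suc k * M + t ≤_) #W big)))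
    g = proj₁ rest
    zero-outside = proj₁ (proj₂ rest)
    g′ : Fin n → Fin (suc (suc k))
    g′ v = if S v then suc zero else lift (g v)
    outside : ∀ v → W v ≡ false → g′ v ≡ zero
    outside v h with S v in eq | zero-outside v
    ... | true | _ = true≢false (S⊆ v eq) h
    ... | false | z rewrite h = cong lift (z refl)
    same : ∀ v → (W v ∧ (g′ v =ᶠ zero)) ≡ ((W ∖ S) v ∧ (g v =ᶠ zero))
    same v with S v | W v | g v
    ... | true | true | _ = refl
    ... | true | false | _ = refl
    ... | false | false | _ = refl
    ... | false | true | zero = refl
    ... | false | true | suc _ = refl
    remainder : # (λ v → W v ∧ (g′ v =ᶠ zero)) + suc k * M ≡ # W
    remainder = begin
      # (λ v → W v ∧ (g′ v =ᶠ zero)) + suc k * M ≡⟨ cong (_+ suc k * M) (#-cong same) ⟩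
      R + (M + k * M) ≡⟨ lem R M (k * M) ⟩
      M + (R + k * M) ≡⟨ cong (M +_) (proj₁ (proj₂ (proj₂ rest))) ⟩
      M + # (W ∖ S) ≡⟨ ≡-sym #W ⟩
      # W ∎
      where
      open ≡-Reasoning
      R = # (λ v → (W ∖ S) v ∧ (g v =ᶠ zero))
      lem : ∀ a b c → a + (b + c) ≡ b + (a + c)
      lem = solve-∀
    first : ∀ v → (g′ v =ᶠ suc zero) ≡ S v
    first v with S v | g v
    ... | true | _ = refl
    ... | false | zero = refl
    ... | false | suc _ = refl
    later : ∀ i v → (g′ v =ᶠ suc (suc i)) ≡ (g v =ᶠ suc i)
    later i v = lem (S v) (g v) λ h → zero-outside v (trans (cong (λ b → W v ∧ not b) h) (∧-zeroʳ (W v)))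
      where
      lem : ∀ b x → (b ≡ true → x ≡ zero) → ((if b then suc zero else lift x) =ᶠ suc (suc i)) ≡ (x =ᶠ suc i)
      lem false zero _ = refl
      lem false (suc _) _ = refl
      lem true x z = cong (_=ᶠ suc i) (≡-sym (z refl))
    parts : ∀ i → Σ (VSet n) λ T → # T ≡ M × Good T × (∀ v → (g′ v =ᶠ suc i) ≡ T v)
    parts zero = S , #S , proj₂ (proj₂ (proj₂ found)) , first
    parts (suc i) = let (T , #T , good , eq) = proj₂ (proj₂ (proj₂ rest)) i in
      T , #T , good , λ v → trans (later i v) (eq v)

  -- Equitable partitions

  ^-distribʳ-* : ∀ k x y → (x * y) ^ k ≡ x ^ k * y ^ k
  ^-distribʳ-* zero x y = refl
  ^-distribʳ-* (suc k) x y = trans (cong (x * y *_) (^-distribʳ-* k x y)) (lem x y (x ^ k) (y ^ k))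
    where
    lem : ∀ a b c d → a * b * (c * d) ≡ a * c * (b * d)
    lem = solve-∀

  n≤2^n : ∀ k → k ≤ 2 ^ k
  n≤2^n zero = z≤n
  n≤2^n (suc k) = ≤-trans (+-mono-≤ (m^n>0 2 k) (n≤2^n k)) (≤-reflexive (cong (2 ^ k +_) (≡-sym (+-identityʳ (2 ^ k)))))

  -- `T` is at most a fraction 1/x of `S`, so the pairs meeting `T` are, like the rare pairs inside
  -- `S`, of order x m². Multiplied by x, everything is at most 5 N² for N = x m + s, and N² ≤ 4 (N
  -- C 2) as N ≥ 2; this gives the constant 20.
  enlarged-homogeneous : ∀ {n} (G : Graph n) c x m s S T → 0 < m → 2 ≤ x → s ≤ m → # S ≡ x * m → # T ≡ s → Disjoint S T →
    between (rel G c) S S ≤ 3 * x * (m * m) →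
    x * between (rel G c) (S ∪ T) (S ∪ T) ≤ 20 * ((x * m + s) C 2) × 0 < (x * m + s) C 2
  enlarged-homogeneous G c x m s S T m>0 2≤x s≤m #S #T disj hS = bound , C>0
    where
    open ≤-Reasoning
    N = x * m + s
    D = between (rel G c)
    2≤N : 2 ≤ N
    2≤N = ≤-trans (*-mono-≤ 2≤x m>0) (m≤m+n (x * m) s)
    N²≤4C : N * N ≤ 4 * (N C 2)
    N²≤4C = +-cancelˡ-≤ (N * N) _ _ (begin
      N * N + N * N ≡⟨ cong₂ _+_ (≡-sym (nC2 N)) (≡-sym (nC2 N)) ⟩
      2 * (N C 2) + N + (2 * (N C 2) + N) ≡⟨ lem N (N C 2) ⟩
      2 * N + 4 * (N C 2) ≤⟨ +-monoˡ-≤ (4 * (N C 2)) (*-monoˡ-≤ N 2≤N) ⟩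
      N * N + 4 * (N C 2) ∎)
      where
      lem : ∀ a b → 2 * b + a + (2 * b + a) ≡ 2 * a + 4 * b
      lem = solve-∀
    C>0 : 0 < N C 2
    C>0 = *-cancelˡ-≤ 4 (≤-trans (*-mono-≤ 2≤N 2≤N) N²≤4C)
    D≤ : D (S ∪ T) (S ∪ T) ≤ 3 * x * (m * m) + s * s + 2 * (x * m * s)
    D≤ = begin
      D (S ∪ T) (S ∪ T) ≡⟨ between-∪ (rel G c) (rel-sym G c) S T disj ⟩
      D S S + D T T + 2 * D S T ≤⟨ +-mono-≤ (+-mono-≤ hS
        (≤-trans (cross-≤ (rel G c) (⟦_⟧ ∘ T) (⟦_⟧ ∘ T)) (≤-reflexive (cong₂ _*_ #T #T))))
        (*-monoʳ-≤ 2 (≤-trans (cross-≤ (rel G c) (⟦_⟧ ∘ S) (⟦_⟧ ∘ T)) (≤-reflexive (cong₂ _*_ #S #T)))) ⟩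
      3 * x * (m * m) + s * s + 2 * (x * m * s) ∎
    bound : x * D (S ∪ T) (S ∪ T) ≤ 20 * (N C 2)
    bound = begin
      x * D (S ∪ T) (S ∪ T) ≤⟨ *-monoʳ-≤ x D≤ ⟩
      x * (3 * x * (m * m) + s * s + 2 * (x * m * s)) ≡⟨ lem₁ x m s ⟩
      3 * (x * m * (x * m)) + x * s * s + 2 * (x * m * (x * s)) ≤⟨ +-mono-≤ (+-monoʳ-≤ (3 * (x * m * (x * m))) (*-monoˡ-≤ s (*-monoʳ-≤ x s≤m))) (*-monoʳ-≤ 2 (*-monoʳ-≤ (x * m) (*-monoʳ-≤ x s≤m))) ⟩
      -- The added terms complete the expression to five times a square.
      3 * (x * m * (x * m)) + x * m * s + 2 * (x * m * (x * m)) ≤⟨ m≤m+n _ (9 * (x * m * s) + 5 * (s * s)) ⟩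
      3 * (x * m * (x * m)) + x * m * s + 2 * (x * m * (x * m)) + (9 * (x * m * s) + 5 * (s * s)) ≡⟨ lem₂ (x * m) s ⟩
      5 * (N * N) ≤⟨ *-monoʳ-≤ 5 N²≤4C ⟩
      5 * (4 * (N C 2)) ≡⟨ ≡-sym (*-assoc 5 4 (N C 2)) ⟩
      20 * (N C 2) ∎
      where
      lem₁ : ∀ x m s → x * (3 * x * (m * m) + s * s + 2 * (x * m * s)) ≡ 3 * (x * m * (x * m)) + x * s * s + 2 * (x * m * (x * s))
      lem₁ = solve-∀
      lem₂ : ∀ y s → 3 * (y * y) + y * s + 2 * (y * y) + (9 * (y * s) + 5 * (s * s)) ≡ 5 * ((y + s) * (y + s))
      lem₂ = solve-∀

  -- `d` stands for 1/ε. The dense case speaks of the number `ē` of non-edges, which keeps 1 - ε and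
  -- truncated subtraction out of the natural-number estimates.
  SparseOrDense : ∀ {n} → ℕ → Graph n → Subset n → Set
  SparseOrDense d G U = d * e G U < size U C 2 ⊎ Σ ℕ λ ē → e G U + ē ≡ size U C 2 × d * ē < size U C 2

  sparseOrDense : ∀ {n} (G : Graph n) d x c (U : Subset n) → 11 * d ≤ x → 0 < size U C 2 →
    x * between (rel G c) (lookup U) (lookup U) ≤ 20 * (size U C 2) → SparseOrDense d G U
  sparseOrDense G d x c U 11d≤x C>0 h = result c h
    where
    open ≤-Reasoning
    B = size U C 2
    D : Bool → ℕ
    D c = between (rel G c) (lookup U) (lookup U)
    -- The assumption says x ē ≤ 10 B, whereas B ≤ d ē would give 11 B ≤ x ē. Taking 11 instead of
    -- 10 makes the conclusion strict, because B > 0.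
    small : ∀ ē → x * (2 * ē) ≤ 20 * B → d * ē < B
    small ē h = ≰⇒> λ C≤ → <⇒≱ C>0 (+-cancelˡ-≤ (10 * B) _ _ (begin
      10 * B + B ≡⟨ +-comm (10 * B) B ⟩
      11 * B ≤⟨ *-monoʳ-≤ 11 C≤ ⟩
      11 * (d * ē) ≡⟨ ≡-sym (*-assoc 11 d ē) ⟩
      11 * d * ē ≤⟨ *-monoˡ-≤ ē 11d≤x ⟩
      x * ē ≤⟨ *-cancelˡ-≤ 2 (begin
        2 * (x * ē) ≡⟨ lem x ē ⟩
        x * (2 * ē) ≤⟨ h ⟩
        20 * B ≡⟨ *-assoc 2 10 B ⟩
        2 * (10 * B) ∎) ⟩
      10 * B ≡⟨ ≡-sym (+-identityʳ (10 * B)) ⟩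
      10 * B + 0 ∎))
      where
      lem : ∀ a b → 2 * (a * b) ≡ a * (2 * b)
      lem = solve-∀
    total : 2 * e G U + D false ≡ 2 * B
    total = +-cancelʳ-≡ (# (lookup U)) _ _ (trans
      (cong (λ y → y + D false + # (lookup U)) (2*e≡between G U))
      (trans (between-complement G (lookup U))
        (≡-sym (subst (λ y → 2 * B + y ≡ y * y) (size≡# U) (nC2 (size U))))))
    e≤C : e G U ≤ B
    e≤C = *-cancelˡ-≤ 2 (≤-trans (m≤m+n (2 * e G U) (D false)) (≤-reflexive total))
    2*ē : D false ≡ 2 * (B ∸ e G U)
    2*ē = +-cancelˡ-≡ (2 * e G U) _ _ (trans total (trans (cong (2 *_) (≡-sym (m+[n∸m]≡n e≤C)))
      (*-distribˡ-+ 2 (e G U) (B ∸ e G U))))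
    result : ∀ c → x * D c ≤ 20 * B → SparseOrDense d G U
    result true h = inj₁ (small (e G U) (subst (λ y → x * y ≤ 20 * B) (≡-sym (2*e≡between G U)) h))
    result false h = inj₂ (B ∸ e G U , m+[n∸m]≡n e≤C , small _ (subst (λ y → x * y ≤ 20 * B) 2*ē h))

  module _ {n q : ℕ} where

    -- `Good` is asked of a set that agrees pointwise with the class, since an arbitrary predicate
    -- on functions need not respect pointwise equality.
    Parts : (VSet n → Set) → ℕ → (Fin n → Fin (suc q)) → Set
    Parts Good M g = ∀ i → Σ (VSet n) λ S → # S ≡ M × Good S × (∀ v → (g v =ᶠ suc i) ≡ S v)

    merge : Fin (suc q) → Fin (suc q) → Fin (suc q)
    merge zero y = y
    merge (suc i) _ = suc i

    module _ (g₁ g₂ : Fin n → Fin (suc q)) where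

      merged : Fin n → Fin (suc q)
      merged v = merge (g₁ v) (g₂ v)

      size-merged-zero : size (class merged zero) ≡ # (λ v → (g₁ v =ᶠ zero) ∧ (g₂ v =ᶠ zero))
      size-merged-zero = trans (size≡# (class merged zero)) (#-cong λ v → trans (lookup∘tabulate _ v) (lem (g₁ v) (g₂ v)))
        where
        lem : ∀ y z → (merge y z =ᶠ zero) ≡ ((y =ᶠ zero) ∧ (z =ᶠ zero))
        lem zero _ = refl
        lem (suc _) _ = refl

      class-merged : (∀ v → (g₁ v =ᶠ zero) ≡ false → g₂ v ≡ zero) → ∀ {A B M s} → Parts A M g₁ → Parts B s g₂ →
        ∀ i → Σ (VSet n) λ S → Σ (VSet n) λ T → # S ≡ M × # T ≡ s × A S × Disjoint S T ×
          (∀ v → lookup (class merged (suc i)) v ≡ (S ∪ T) v)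
      class-merged outside p₁ p₂ i with p₁ i | p₂ i
      ... | (S , #S , a , S≡) | (T , #T , _ , T≡) = S , T , #S , #T , a , disjoint , λ v →
        trans (lookup∘tabulate _ v) (trans (lem (g₁ v) (g₂ v) (outside v)) (cong₂ _∨_ (S≡ v) (T≡ v)))
        where
        lem : ∀ y z → ((y =ᶠ zero) ≡ false → z ≡ zero) → (merge y z =ᶠ suc i) ≡ ((y =ᶠ suc i) ∨ (z =ᶠ suc i))
        lem zero z _ = refl
        lem (suc j) z o rewrite o refl = ≡-sym (∨-identityʳ _)
        disjoint : Disjoint S T
        disjoint v h = trans (≡-sym (T≡ v)) (cong (_=ᶠ suc i) (outside v
          (cong (_=ᶠ zero) (does-true (g₁ v Fin.≟ suc i) (trans (S≡ v) h)))))

  -- The greedy selection covers all but ρ + K * m ≤ 2 * K * m vertices by 2 * K sets, so each set receives at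
  -- most m of the remaining ones.
  equitable-partition : ∀ {n} (G : Graph n) d x K m ρ → 11 * d ≤ x → 2 ≤ x → 0 < K → 0 < m → ρ ≤ m →
    n ≡ ρ + m * (2 * K * x + K) →
    (∀ W → K * m ≤ # W → Σ (VSet n) λ S → S ⊆ W × # S ≡ x * m × Σ Bool λ c → between (rel G c) S S ≤ 3 * x * (m * m)) →
    Σ (Fin n → Fin (suc (2 * K))) λ part → Equitable (2 * K) part × (∀ i → SparseOrDense d G (class part (suc i)))
  equitable-partition {n} G d x K m ρ 11d≤x 2≤x K>0 m>0 ρ≤m n≡ find =
    enlarge (greedy-partition Good (x * m) (K * m) (λ W big → find W (≤-trans (m≤n+m (K * m) (x * m)) big)) q (λ _ → true)
      (≤-trans (m≤n+m _ ρ) (≤-reflexive (trans (≡-sym n≡′) (≡-sym (#-full n))))))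
    where
    q = 2 * K
    instance
      nz-q : NonZero q
      nz-q = >-nonZero (≤-trans K>0 (m≤m+n K (K + 0)))
    Good : VSet n → Set
    Good S = Σ Bool λ c → between (rel G c) S S ≤ 3 * x * (m * m)
    n≡′ : n ≡ ρ + (q * (x * m) + K * m)
    n≡′ = trans n≡ (cong (ρ +_) (lem m q x K))
      where
      lem : ∀ m q x K → m * (q * x + K) ≡ q * (x * m) + K * m
      lem = solve-∀

    conclude : ∀ g₁ g₂ R s → s ≤ m → (∀ v → (g₁ v =ᶠ zero) ≡ false → g₂ v ≡ zero) →
      # (λ v → (g₁ v =ᶠ zero) ∧ (g₂ v =ᶠ zero)) ≡ R % q → Parts Good (x * m) g₁ → Parts (λ _ → ⊤) s g₂ →
      Σ (Fin n → Fin (suc q)) λ part → Equitable q part × (∀ i → SparseOrDense d G (class part (suc i)))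
    conclude g₁ g₂ R s s≤m outside V₀≡ p₁ p₂ = merged g₁ g₂ ,
      (subst (_< q) (≡-sym (trans (size-merged-zero g₁ g₂) V₀≡)) (m%n<n R q) ,
       λ i j → trans (proj₁ (analyse i)) (≡-sym (proj₁ (analyse j)))) ,
      λ i → proj₂ (analyse i)
      where
      analyse : ∀ i → size (class (merged g₁ g₂) (suc i)) ≡ x * m + s × SparseOrDense d G (class (merged g₁ g₂) (suc i))
      analyse i with class-merged g₁ g₂ outside p₁ p₂ i
      ... | (S , T , #S , #T , (c , sparse) , disj , U≡) = |U| , sparseOrDense G d x c U 11d≤x
          (subst (λ N → 0 < N C 2) (≡-sym |U|) (proj₂ bounds))
          (subst₂ (λ y N → x * y ≤ 20 * (N C 2))
            (cross-cong (rel G c) (λ v → cong ⟦_⟧ (≡-sym (U≡ v))) (λ v → cong ⟦_⟧ (≡-sym (U≡ v)))) (≡-sym |U|) (proj₁ bounds))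
        where
        U = class (merged g₁ g₂) (suc i)
        |U| : size U ≡ x * m + s
        |U| = trans (size≡# U) (trans (#-cong U≡) (trans (#-∪ S T disj) (cong₂ _+_ #S #T)))
        bounds = enlarged-homogeneous G c x m s S T m>0 2≤x s≤m #S #T disj sparse

    enlarge : (Σ (Fin n → Fin (suc q)) λ g → (∀ v → true ≡ false → g v ≡ zero) ×
        # (λ v → g v =ᶠ zero) + q * (x * m) ≡ # {n} (λ _ → true) × Parts Good (x * m) g) →
      Σ (Fin n → Fin (suc q)) λ part → Equitable q part × (∀ i → SparseOrDense d G (class part (suc i)))
    -- A second greedy selection, with no condition on the sets, cuts the `R` remaining vertices
    -- into `q` sets of size `R / q`. The `R % q` vertices left after it form the exceptional class,
    -- which is why that class has fewer than `q` elements.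
    enlarge (g₁ , _ , rem₁ , p₁)
      with greedy-partition (λ _ → ⊤) (# (λ v → g₁ v =ᶠ zero) / q) 0
        (λ W big → let (S , S⊆ , #S) = subset-of-size W _ (≤-trans (m≤m+n _ 0) big) in S , S⊆ , #S , tt)
        q (λ v → g₁ v =ᶠ zero)
        (≤-trans (≤-reflexive (trans (+-identityʳ _) (*-comm q _))) (m/n*n≤m (# (λ v → g₁ v =ᶠ zero)) q))
    ... | (g₂ , outside , rem₂ , p₂) = conclude g₁ g₂ R s s≤m outside V₀≡ p₁ p₂
      where
      R = # (λ v → g₁ v =ᶠ zero)
      s = R / q
      R≡ : R ≡ ρ + K * m
      R≡ = +-cancelʳ-≡ (q * (x * m)) _ _ (trans rem₁ (trans (#-full n) (trans n≡′ (lem ρ (q * (x * m)) (K * m)))))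
        where
        lem : ∀ a b c → a + (b + c) ≡ a + c + b
        lem = solve-∀
      s≤m : s ≤ m
      s≤m = *-cancelʳ-≤ s m q (begin
        s * q ≤⟨ m/n*n≤m R q ⟩
        R ≡⟨ R≡ ⟩
        ρ + K * m ≤⟨ +-monoˡ-≤ (K * m) (≤-trans ρ≤m (m≤n*m m K {{>-nonZero K>0}})) ⟩
        K * m + K * m ≡⟨ lem K m ⟩
        m * q ∎)
        where
        open ≤-Reasoning
        lem : ∀ a b → a * b + a * b ≡ b * (2 * a)
        lem = solve-∀
      V₀≡ : # (λ v → (g₁ v =ᶠ zero) ∧ (g₂ v =ᶠ zero)) ≡ R % q
      V₀≡ = +-cancelʳ-≡ (q * s) _ _ (trans rem₂ (trans (m≡m%n+[m/n]*n R q) (cong (R % q +_) (*-comm s q))))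

  -- Choice of the constants

  few-copies-scaled : ∀ {r n} (H : Graph r) (G : Graph n) P m → n ≤ 2 * P * m →
    suc ((2 * P) ^ r * r ^ r) * kH H G < n ^ r → copies G r (adj H) (λ _ _ → true) < m ^ r
  few-copies-scaled {r} {n} H G P m n≤2Pm few = ≤-<-trans (copies≤kH H G) (*-cancelˡ-< ((2 * P) ^ r) _ _ (begin-strict
      (2 * P) ^ r * (kH H G * r ^ r) ≡⟨ lem ((2 * P) ^ r) (kH H G) (r ^ r) ⟩
      (2 * P) ^ r * r ^ r * kH H G ≤⟨ *-monoˡ-≤ (kH H G) (n≤1+n ((2 * P) ^ r * r ^ r)) ⟩
      suc ((2 * P) ^ r * r ^ r) * kH H G <⟨ few ⟩
      n ^ r ≤⟨ ^-monoˡ-≤ r n≤2Pm ⟩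
      (2 * P * m) ^ r ≡⟨ ^-distribʳ-* r (2 * P) m ⟩
      (2 * P) ^ r * m ^ r ∎))
    where
    open ≤-Reasoning
    lem : ∀ a b c → a * (b * c) ≡ a * c * b
    lem = solve-∀

  few-copies⇒partition : ∀ d r → Σ ℕ λ z → Σ ℕ λ L → Σ ℕ λ n₀ →
    ∀ (H : Graph r) (n : ℕ) → n₀ ≤ n → (G : Graph n) → suc z * kH H G < n ^ r →
    Σ ℕ λ q → q < L × Σ (Fin n → Fin (suc q)) λ part → Equitable q part ×
      (∀ (i : Fin q) → SparseOrDense d G (class part (suc i)))
  -- With x = 2^(4 + d) = 16 * 2^d and 2^d ≥ d, the summand 4 absorbs the constant 11 of
  -- `sparseOrDense`.
  few-copies⇒partition d r = from-homogeneous (4 + d) 2≤x 11d≤x (homogeneous-set r (4 + d) (4 + d))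
    where
    2≤x : 2 ≤ 2 ^ (4 + d)
    2≤x = *-monoʳ-≤ 2 (m^n>0 2 (3 + d))
    11d≤x : 11 * d ≤ 2 ^ (4 + d)
    11d≤x = ≤-trans (*-mono-≤ (m≤m+n 11 5) (n≤2^n d)) (≤-reflexive (≡-sym (^-distribˡ-+-* 2 4 d)))
    from-homogeneous : ∀ a → 2 ≤ 2 ^ a → 11 * d ≤ 2 ^ a →
      (Σ ℕ λ K → 0 < K × (∀ {n} (G : Graph n) c W m → 0 < m → copies G r c (λ _ _ → true) < m ^ r → K * m ≤ # W →
        HomogeneousSet G true a m W ⊎ HomogeneousSet G false a m W)) →
      Σ ℕ λ z → Σ ℕ λ L → Σ ℕ λ n₀ →
      ∀ (H : Graph r) (n : ℕ) → n₀ ≤ n → (G : Graph n) → suc z * kH H G < n ^ r →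
      Σ ℕ λ q → q < L × Σ (Fin n → Fin (suc q)) λ part → Equitable q part ×
        (∀ (i : Fin q) → SparseOrDense d G (class part (suc i)))
    -- In the first constant, (2P)^r comes from n ≤ 2 P m and r^r from counting embeddings instead
    -- of induced copies. The threshold `P * P` makes the quotient m of n by P at least P, hence at
    -- least the remainder ρ.
    from-homogeneous a 2≤x 11d≤x (K , K>0 , hom) = (2 * P) ^ r * r ^ r , suc (2 * K) , P * P , main
      where
      -- `P * m` vertices provide `2 * K` sets of size `2 ^ a * m` and the `K * m` vertices that the
      -- search for a set needs to start.
      P = 2 * K * 2 ^ a + K
      P>0 : 0 < P
      P>0 = ≤-trans K>0 (m≤n+m K (2 * K * 2 ^ a))
      instance
        nz-P : NonZero P
        nz-P = >-nonZero P>0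
      main : ∀ (H : Graph r) (n : ℕ) → P * P ≤ n → (G : Graph n) → suc ((2 * P) ^ r * r ^ r) * kH H G < n ^ r →
        Σ ℕ λ q → q < suc (2 * K) × Σ (Fin n → Fin (suc q)) λ part → Equitable q part ×
          (∀ (i : Fin q) → SparseOrDense d G (class part (suc i)))
      main H n n₀≤n G few = 2 * K , ≤-refl ,
        equitable-partition G d (2 ^ a) K m ρ 11d≤x 2≤x K>0 m>0 (≤-trans ρ≤P P≤m) n≡ find
        where
        m = n / P
        ρ = n % P
        n≡ : n ≡ ρ + m * P
        n≡ = m≡m%n+[m/n]*n n P
        P≤m : P ≤ m
        P≤m = ≤-trans (≤-reflexive (≡-sym (m*n/n≡m P P))) (/-monoˡ-≤ P n₀≤n)
        m>0 : 0 < m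
        m>0 = ≤-trans P>0 P≤m
        ρ≤P : ρ ≤ P
        ρ≤P = <⇒≤ (m%n<n n P)
        n≤2Pm : n ≤ 2 * P * m
        n≤2Pm = begin
          n ≡⟨ n≡ ⟩
          ρ + m * P ≤⟨ +-monoˡ-≤ (m * P) (≤-trans ρ≤P (m≤n*m P m {{>-nonZero m>0}})) ⟩
          m * P + m * P ≡⟨ lem m P ⟩
          2 * P * m ∎
          where
          open ≤-Reasoning
          lem : ∀ a b → a * b + a * b ≡ 2 * b * a
          lem = solve-∀
        find : ∀ W → K * m ≤ # W → Σ (VSet n) λ S → S ⊆ W × # S ≡ 2 ^ a * m ×
          Σ Bool λ c → between (rel G c) S S ≤ 3 * 2 ^ a * (m * m)
        find W big with hom G (adj H) W m m>0 (few-copies-scaled H G P m n≤2Pm few) big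
        ... | inj₁ (S , S⊆ , #S , h) = S , S⊆ , #S , true , ≤-trans (m≤m+n _ _) h
        ... | inj₂ (S , S⊆ , #S , h) = S , S⊆ , #S , false , ≤-trans (m≤m+n _ _) h

-- From natural-number inequalities to rational densities

module Rationals where

  open import Data.Integer as ℤ using (+_; +[1+_])
  import Data.Integer.Properties as ℤ
  import Data.Nat as ℕ
  import Data.Nat.Properties as ℕ
  open import Data.Rational using (ℚ; mkℚ; 0ℚ; 1ℚ; _+_; _*_; _-_; -_; _/_; *<*; toℚᵘ; ↧ₙ_) renaming (_<_ to _<ℚ_)
  open import Data.Rational.Properties
  open import Data.Rational.Unnormalised as ℚᵘ using (mkℚᵘ)
  import Data.Rational.Unnormalised.Properties as ℚᵘ

  toℚᵘ-toℚ : ∀ k → toℚᵘ (toℚ k) ℚᵘ.≃ mkℚᵘ (+ k) 0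
  toℚᵘ-toℚ k = toℚᵘ-fromℚᵘ (mkℚᵘ (+ k) 0)

  toℚᵘ-*-toℚ : ∀ p k → toℚᵘ (p * toℚ k) ℚᵘ.≃ toℚᵘ p ℚᵘ.* mkℚᵘ (+ k) 0
  toℚᵘ-*-toℚ p k = ℚᵘ.≃-trans (toℚᵘ-homo-* p (toℚ k)) (ℚᵘ.*-congˡ {toℚᵘ p} (toℚᵘ-toℚ k))

  toℚ-+ : ∀ j k → toℚ (j ℕ.+ k) ≡ toℚ j + toℚ k
  toℚ-+ j k = toℚᵘ-injective (ℚᵘ.≃-trans (toℚᵘ-toℚ (j ℕ.+ k)) (ℚᵘ.≃-sym (ℚᵘ.≃-trans (toℚᵘ-homo-+ (toℚ j) (toℚ k))
    (ℚᵘ.≃-trans (ℚᵘ.+-cong (toℚᵘ-toℚ j) (toℚᵘ-toℚ k)) (ℚᵘ.*≡* (cong (ℤ._* + 1) (cong₂ ℤ._+_ (ℤ.*-identityʳ (+ j)) (ℤ.*-identityʳ (+ k)))))))))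

  unit-fraction : ℕ → ℚ
  unit-fraction z = + 1 / suc z

  unit-fraction>0 : ∀ z → 0ℚ <ℚ unit-fraction z
  unit-fraction>0 z = toℚᵘ-cancel-< (ℚᵘ.<-respʳ-≃ (ℚᵘ.≃-sym (toℚᵘ-fromℚᵘ (mkℚᵘ (+ 1) z))) (ℚᵘ.*<* (ℤ.+<+ (ℕ.s≤s ℕ.z≤n))))

  <-unit-fraction-* : ∀ z k N → toℚ k <ℚ unit-fraction z * toℚ N → suc z ℕ.* k ℕ.< N
  <-unit-fraction-* z k N h = ℤ.drop‿+<+ (subst₂ ℤ._<_
      (trans (≡-sym (ℤ.pos-* k _)) (cong +_ (trans (cong (k ℕ.*_) (ℕ.*-identityʳ (suc z))) (ℕ.*-comm k (suc z)))))
      (trans (ℤ.*-identityʳ _) (ℤ.*-identityˡ (+ N)))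
      (ℚᵘ.drop-*<* unnormalised))
    where
    unnormalised : mkℚᵘ (+ k) 0 ℚᵘ.< mkℚᵘ (+ 1) z ℚᵘ.* mkℚᵘ (+ N) 0
    unnormalised = ℚᵘ.<-respˡ-≃ (toℚᵘ-toℚ k) (ℚᵘ.<-respʳ-≃
      (ℚᵘ.≃-trans (toℚᵘ-*-toℚ (unit-fraction z) N) (ℚᵘ.*-cong (toℚᵘ-fromℚᵘ (mkℚᵘ (+ 1) z)) ℚᵘ.≃-refl))
      (toℚᵘ-mono-< h))

  -- A positive ε has numerator at least 1, so it is at least the reciprocal of its denominator.
  <-*-toℚ : ∀ ε → 0ℚ <ℚ ε → ∀ k N → ↧ₙ ε ℕ.* k ℕ.< N → toℚ k <ℚ ε * toℚ N
  <-*-toℚ (mkℚ (+ 0) d _) (*<* (ℤ.+<+ ())) k N h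
  <-*-toℚ ε@(mkℚ +[1+ p ] d _) _ k N h = toℚᵘ-cancel-< (ℚᵘ.<-respˡ-≃ (ℚᵘ.≃-sym (toℚᵘ-toℚ k))
    (ℚᵘ.<-respʳ-≃ (ℚᵘ.≃-sym (toℚᵘ-*-toℚ ε N)) (ℚᵘ.*<* (subst₂ ℤ._<_
      (trans (cong +_ (trans (ℕ.*-comm (suc d) k) (cong (k ℕ.*_) (≡-sym (ℕ.*-identityʳ (suc d)))))) (ℤ.pos-* k _))
      (trans (ℤ.pos-* (suc p) N) (≡-sym (ℤ.*-identityʳ _)))
      (ℤ.+<+ (ℕ.<-≤-trans h (ℕ.m≤m+n N (p ℕ.* N))))))))
  <-*-toℚ (mkℚ (ℤ.-[1+ _ ]) d _) (*<* ()) k N h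

  -- Turns few non-edges into many edges: N - ε N < N - k = j.
  [1-ε]*-<-toℚ : ∀ ε j k N → j ℕ.+ k ≡ N → toℚ k <ℚ ε * toℚ N → (1ℚ - ε) * toℚ N <ℚ toℚ j
  [1-ε]*-<-toℚ ε j k N refl h = subst₂ _<ℚ_
    (≡-sym (trans (*-distribʳ-+ x 1ℚ (- ε)) (cong₂ _+_ (*-identityˡ x) (≡-sym (neg-distribˡ-* ε x)))))
    (trans (cong (_- toℚ k) (toℚ-+ j k)) (trans (+-assoc (toℚ j) (toℚ k) (- toℚ k))
      (trans (cong (λ y → toℚ j + y) (+-inverseʳ (toℚ k))) (+-identityʳ (toℚ j)))))
    (+-monoʳ-< x (neg-antimono-< h))
    where x = toℚ (j ℕ.+ k)

open import Data.Rational using (ℚ; 0ℚ; 1ℚ; _*_; _-_; ↧ₙ_) renaming (_<_ to _<ℚ_)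
open Combinatorics using (few-copies⇒partition)
open Rationals

theorem5 : (ε : ℚ) → 0ℚ <ℚ ε → (r : ℕ) → 2 ≤ r →
    Σ ℚ λ ξ → 0ℚ <ℚ ξ × Σ ℕ λ L → Σ ℕ λ n₀ →
      ∀ (H : Graph r) (n : ℕ) → n₀ ≤ n → (G : Graph n) →
      toℚ (kH H G) <ℚ ξ * toℚ (n ^ r) →
      Σ ℕ λ q → q < L × Σ (Fin n → Fin (suc q)) λ part → Equitable q part ×
        (∀ (i : Fin q) →
          toℚ (e G (class part (Fin.suc i))) <ℚ ε * toℚ (size (class part (Fin.suc i)) C 2)
          ⊎ (1ℚ - ε) * toℚ (size (class part (Fin.suc i)) C 2) <ℚ toℚ (e G (class part (Fin.suc i))))
theorem5 ε ε>0 r _ = case few-copies⇒partition (↧ₙ ε) r of λ { (z , L , n₀ , partition) →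
  unit-fraction z , unit-fraction>0 z , L , n₀ , λ H n n₀≤n G few →
  case partition H n n₀≤n G (<-unit-fraction-* z (kH H G) (n ^ r) few) of λ { (q , q<L , part , equitable , homogeneous) →
  q , q<L , part , equitable , λ i →
    Sum.map (<-*-toℚ ε ε>0 _ _)
            (λ { (ē , e+ē≡ , small) → [1-ε]*-<-toℚ ε _ ē _ e+ē≡ (<-*-toℚ ε ε>0 _ _ small) })
            (homogeneous i) } }
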